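{- For every integer $q\ge2$ and every integer $n\ge n_0(q)$, where $n_0(2)=37$, $n_0(3)=97$, and $n_0(q)=45q-8$ for $q\ge4$, one has $\tau^v_{3q}(n)=\lceil n/3\rceil$.
   Context: An oriented graph is an orientation of a (finite) simple graph: no loops, and at most one arc on each unordered pair of vertices. $\delta^0(G)=\min_{v}\min\{d^+(v),d^-(v)\}$ is the minimum semidegree. $C_\ell$ denotes the consistently oriented (directed) cycle of length $\ell$. For $\ell\ge3$, $\tau^v_\ell(n)$ is the least integer $d$ such that in every $n$-vertex oriented graph $G$ with $\delta^0(G)\ge d$, every vertex of $G$ lies on a copy of $C_\ell$. -}

module Defs where

open import Data.Fin.Base using (Fin; toℕ)
open import Data.Fin.Subset using (Subset; ∣_∣)
open import Data.List.Base using (map; allFin)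
open import Data.List.Extrema.Nat using (min)
open import Data.Nat.Base using (ℕ; suc; _+_; _*_; _∸_; _⊓_; _≤_; _≥_; _/_)
open import Data.Nat.DivMod using (_mod_)
open import Data.Product.Base using (∃-syntax; _×_)
open import Data.Vec.Base using (tabulate)
open import Function.Definitions using (Injective)
open import Level using (0ℓ)
open import Relation.Binary.Core using (Rel)
open import Relation.Binary.Definitions using (Asymmetric; Decidable; Irreflexive)
open import Relation.Binary.PropositionalEquality.Core using (_≡_)
open import Relation.Nullary.Decidable.Core using (does)

-- The vertex set is Fin n.  Decidability of arcs is what makes the graph a
-- finite object constructively: it is needed to count neighbours.
record OrientedGraph (n : ℕ) : Set₁ where
  infix 4 _⟶_ _⟶?_
  field
    _⟶_    : Rel (Fin n) 0ℓ
    _⟶?_   : Decidable _⟶_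
    irrefl : Irreflexive _≡_ _⟶_
    asym   : Asymmetric _⟶_

  N⁺ N⁻ : Fin n → Subset n
  N⁺ v = tabulate λ w → does (v ⟶? w)
  N⁻ v = tabulate λ u → does (u ⟶? v)

  d⁺ d⁻ : Fin n → ℕ
  d⁺ v = ∣ N⁺ v ∣
  d⁻ v = ∣ N⁻ v ∣

  -- The first argument of min is the value on the empty list; since every
  -- degree is at most n, it does not affect the minimum when n ≥ 1.
  δ⁰ : ℕ
  δ⁰ = min n (map (λ v → d⁺ v ⊓ d⁻ v) (allFin n))

next : ∀ {ℓ} → Fin ℓ → Fin ℓ
next {suc k} i = suc (toℕ i) mod suc k

-- A (not necessarily induced) copy of the directed cycle
-- 0 → 1 → ⋯ → ℓ-1 → 0 in G.
record CycleCopy {n : ℕ} (G : OrientedGraph n) (ℓ : ℕ) : Set where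
  open OrientedGraph G
  field
    vertex    : Fin ℓ → Fin n
    injective : Injective _≡_ _≡_ vertex
    arc       : ∀ i → vertex i ⟶ vertex (next i)

LiesOn : ∀ {n ℓ} {G : OrientedGraph n} → Fin n → CycleCopy G ℓ → Set
LiesOn v C = ∃[ i ] CycleCopy.vertex C i ≡ v

EveryVertexOnCycle : ∀ {n} → OrientedGraph n → ℕ → Set
EveryVertexOnCycle {n} G ℓ = ∀ (v : Fin n) → ∃[ C ] LiesOn {ℓ = ℓ} {G = G} v C

ForcesVertexCycles : (ℓ n d : ℕ) → Set₁
ForcesVertexCycles ℓ n d =
  ∀ (G : OrientedGraph n) → OrientedGraph.δ⁰ G ≥ d → EveryVertexOnCycle G ℓ

IsLeast : (ℕ → Set₁) → ℕ → Set₁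
IsLeast P d = P d × (∀ d′ → P d′ → d ≤ d′)

-- "τᵛ_ℓ(n) = d".  As δ⁰ ≥ 0, a negative threshold imposes the same
-- condition as 0, so thresholds range over ℕ.
τᵛ[_,_]≡_ : (ℓ n d : ℕ) → Set₁
τᵛ[ ℓ , n ]≡ d = IsLeast (ForcesVertexCycles ℓ n) d

⌈_/3⌉ : ℕ → ℕ
⌈ n /3⌉ = (n + 2) / 3

-- Only the values at q ≥ 2 are meaningful; there 45 * q ≥ 8, so ∸ is
-- ordinary subtraction.
n₀ : ℕ → ℕ
n₀ 2 = 37
n₀ 3 = 97
n₀ q = 45 * q ∸ 8

{-# OPTIONS --safe #-}

-- Write d = ⌈n/3⌉, A = N⁺(v) and B = N⁻(v).  The basic fact is that a nonempty set P
-- contains a vertex with at most (|P| - 1)/2 out-neighbours in P, so that balls grow.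
--
-- If A is independent, the degrees force n = 3d and make every vertex of A adjacent
-- to every vertex outside A.  A cycle v a₁ w₁ w₁′ a₂ w₂ w₂′ ⋯ a_q b is then built
-- backwards from b; a set of vertices outside A all of whose steps back fail would be
-- nearly closed under in-neighbours and hence contain a vertex of too small
-- in-degree.  If B is independent, reverse all arcs.
--
-- Otherwise A contains an arc y → z and B an arc z′ → y′, so v reaches z by 1 or 2 arcs
-- and z′ reaches v by 1 or 2 arcs.  For q = 2, balls of radius 2 around z and z′ meet.
-- For q ≥ 3, prolong the path from z′ backwards to a vertex t.  If N⁺(z) contains a path
-- x₁ x₂ x₃, then v reaches x₃ by 2, 3, 4 or 5 arcs and balls of radius 3 around x₃ and t
-- meet; if not, then N⁺(z) has a sink, the ball of radius 2 around z has about 2d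
-- vertices and meets the ball of radius 2 around t.  The choice of lengths near v
-- compensates for the unknown length of the connecting path.
--
-- For the lower bound, v is added to a blow-up of the directed triangle in such a way
-- that all cycles through v have length 1 modulo 3.
module Submission where

open import Defs

import Algebra.Properties.CommutativeSemigroup
import Algebra.Properties.Semiring.Sum
open import Data.Bool.Base as Bool using (Bool; true; false; if_then_else_; _∧_)
open import Data.Bool.Properties using (T-∧)
open import Data.Empty using (⊥; ⊥-elim)
open import Data.Fin.Base using (Fin; zero; suc; toℕ)
open import Data.Fin.Properties using (_≟_; any?; toℕ-injective; toℕ<n; toℕ-fromℕ<)
open import Data.Fin.Subset using (∣_∣)
open import Data.List.Base using (List; []; _∷_; length; _++_; reverse; lookup; allFin; map)
open import Data.List.Extrema.Nat using (min≤v⁺; v≤min⁺)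
open import Data.List.Membership.Propositional using (_∈_; _∉_)
open import Data.List.Membership.Propositional.Properties using (∈-++⁺ˡ; ∈-++⁺ʳ; ∈-++⁻; ∈-allFin; ∈-lookup)
import Data.List.Membership.DecPropositional as DecMembership
open import Data.List.Properties using (unfold-reverse; length-reverse; length-++)
open import Data.List.Relation.Binary.Permutation.Propositional using (↭-sym; ↭⇒↭ₛ)
open import Data.List.Relation.Binary.Permutation.Propositional.Properties using (↭-reverse)
import Data.List.Relation.Binary.Permutation.Setoid.Properties as Permutation
open import Data.List.Relation.Unary.All as All using (All; []; _∷_)
import Data.List.Relation.Unary.All.Properties as All
open import Data.List.Relation.Unary.AllPairs using ([]; _∷_)
open import Data.List.Relation.Unary.Any as Any using (here; there)
import Data.List.Relation.Unary.Any.Properties as Any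
open import Data.List.Relation.Unary.Unique.Propositional using (Unique)
open import Data.List.Relation.Unary.Unique.Propositional.Properties using () renaming (++⁺ to unique-++)
open import Data.Nat.Base
open import Data.Nat.DivMod
open import Data.Nat.Properties hiding (_≟_)
open import Data.Nat.Tactic.RingSolver using (solve-∀)
open import Data.Product.Base using (∃-syntax; Σ-syntax; _×_; _,_; proj₁; proj₂)
open import Data.Sum.Base using (_⊎_; inj₁; inj₂; [_,_]′)
open import Data.Unit.Base using (⊤; tt)
open import Data.Vec.Base as Vec using (Vec; []; _∷_; tabulate)
open import Data.Vec.N-ary using (N-ary; _$ⁿ_)
open import Function.Base using (_∘_; id; flip)
open import Function.Bundles using (Equivalence)
open import Level using (0ℓ)
open import Relation.Binary.Core using (Rel)
open import Relation.Binary.PropositionalEquality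
open import Relation.Nullary using (¬_; Dec; yes; no; does; _×-dec_; ¬?; _⊎-dec_; contradiction; decidable-stable)
open import Relation.Unary using (Pred; Decidable)

open Algebra.Properties.CommutativeSemigroup *-commutativeSemigroup using (x∙yz≈y∙xz)
open Algebra.Properties.Semiring.Sum +-*-semiring using (sum; ∑-comm; ∑-distrib-+; *-distribʳ-sum)

-- Linear arithmetic by Farkas certificates

-- m ∙ h is a hypothesis with its multiplier.  The goal l ≼ r follows from the combined
-- hypothesis p ≼ q if q + l is coefficientwise at most p + r.
infixr 9 _:*_
infixl 8 _:+_
infix  7 _≼_
infix  6 _∙_
infix  4 _⊢_

data Lin (k : ℕ) : Set where
  var  : Fin k → Lin k
  con  : ℕ → Lin k
  _:+_ : Lin k → Lin k → Lin k
  _:*_ : ℕ → Lin k → Lin k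

record Ineq (k : ℕ) : Set where
  constructor _≼_
  field lhs rhs : Lin k

data Scaled (k : ℕ) : Set where
  _∙_ : ℕ → Ineq k → Scaled k

data Problem (k : ℕ) : Set where
  _⊢_ : List (Scaled k) → Ineq k → Problem k

module _ {k : ℕ} where

  ⟦_⟧ : Lin k → Vec ℕ k → ℕ
  ⟦ var i ⟧    ρ = Vec.lookup ρ i
  ⟦ con c ⟧    ρ = c
  ⟦ e :+ e′ ⟧  ρ = ⟦ e ⟧ ρ + ⟦ e′ ⟧ ρ
  ⟦ c :* e ⟧   ρ = c * ⟦ e ⟧ ρ

  Holds : Ineq k → Vec ℕ k → Set
  Holds (l ≼ r) ρ = ⟦ l ⟧ ρ ≤ ⟦ r ⟧ ρ

  Valid : Problem k → Vec ℕ k → Set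
  Valid ([] ⊢ g)             ρ = Holds g ρ
  Valid (((m ∙ h) ∷ hs) ⊢ g) ρ = Holds h ρ → Valid (hs ⊢ g) ρ

Normal : ℕ → Set
Normal k = ℕ × Vec ℕ k

private
  dot : ∀ {k} → Vec ℕ k → Vec ℕ k → ℕ
  dot []       []      = 0
  dot (c ∷ cs) (x ∷ ρ) = c * x + dot cs ρ

  value : ∀ {k} → Normal k → Vec ℕ k → ℕ
  value (c , cs) ρ = c + dot cs ρ

  unit : ∀ {k} → Fin k → Vec ℕ k
  unit Fin.zero    = 1 ∷ Vec.replicate _ 0
  unit (Fin.suc i) = 0 ∷ unit i

  _+ⁿ_ : ∀ {k} → Normal k → Normal k → Normal k
  (c , cs) +ⁿ (c′ , cs′) = c + c′ , Vec.zipWith _+_ cs cs′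

  _*ⁿ_ : ∀ {k} → ℕ → Normal k → Normal k
  m *ⁿ (c , cs) = m * c , Vec.map (m *_) cs

  normal : ∀ {k} → Lin k → Normal k
  normal (var i)   = 0 , unit i
  normal (con c)   = c , Vec.replicate _ 0
  normal (e :+ e′) = normal e +ⁿ normal e′
  normal (c :* e)  = c *ⁿ normal e

  dot-0 : ∀ {k} (ρ : Vec ℕ k) → dot (Vec.replicate k 0) ρ ≡ 0
  dot-0 []      = refl
  dot-0 (x ∷ ρ) = dot-0 ρ

  dot-unit : ∀ {k} (i : Fin k) (ρ : Vec ℕ k) → dot (unit i) ρ ≡ Vec.lookup ρ i
  dot-unit Fin.zero    (x ∷ ρ) = trans (cong₂ _+_ (+-identityʳ x) (dot-0 ρ)) (+-identityʳ x)
  dot-unit (Fin.suc i) (x ∷ ρ) = dot-unit i ρ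

  dot-+ : ∀ {k} (cs cs′ ρ : Vec ℕ k) → dot (Vec.zipWith _+_ cs cs′) ρ ≡ dot cs ρ + dot cs′ ρ
  dot-+ []       []         []      = refl
  dot-+ (c ∷ cs) (c′ ∷ cs′) (x ∷ ρ) = trans (cong ((c + c′) * x +_) (dot-+ cs cs′ ρ)) (lemma c c′ x _ _)
    where
    lemma : ∀ c c′ x a b → (c + c′) * x + (a + b) ≡ (c * x + a) + (c′ * x + b)
    lemma = solve-∀

  dot-* : ∀ {k} m (cs ρ : Vec ℕ k) → dot (Vec.map (m *_) cs) ρ ≡ m * dot cs ρ
  dot-* m []       []      = sym (*-zeroʳ m)
  dot-* m (c ∷ cs) (x ∷ ρ) = trans (cong (m * c * x +_) (dot-* m cs ρ)) (lemma m c x _)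
    where
    lemma : ∀ m c x a → m * c * x + m * a ≡ m * (c * x + a)
    lemma = solve-∀

  value-+ : ∀ {k} (p q : Normal k) ρ → value (p +ⁿ q) ρ ≡ value p ρ + value q ρ
  value-+ (c , cs) (c′ , cs′) ρ = trans (cong (c + c′ +_) (dot-+ cs cs′ ρ)) (lemma c c′ _ _)
    where
    lemma : ∀ c c′ a b → c + c′ + (a + b) ≡ (c + a) + (c′ + b)
    lemma = solve-∀

  value-* : ∀ {k} m (p : Normal k) ρ → value (m *ⁿ p) ρ ≡ m * value p ρ
  value-* m (c , cs) ρ = trans (cong (m * c +_) (dot-* m cs ρ)) (sym (*-distribˡ-+ m c _))

  normal-correct : ∀ {k} (e : Lin k) ρ → value (normal e) ρ ≡ ⟦ e ⟧ ρ
  normal-correct (var i)   ρ = dot-unit i ρ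
  normal-correct (con c)   ρ = trans (cong (c +_) (dot-0 ρ)) (+-identityʳ c)
  normal-correct (e :+ e′) ρ = trans (value-+ (normal e) (normal e′) ρ) (cong₂ _+_ (normal-correct e ρ) (normal-correct e′ ρ))
  normal-correct (c :* e)  ρ = trans (value-* c (normal e) ρ) (cong (c *_) (normal-correct e ρ))

  _≤ᵛ_ : ∀ {k} → Vec ℕ k → Vec ℕ k → Bool
  []       ≤ᵛ []         = true
  (c ∷ cs) ≤ᵛ (c′ ∷ cs′) = (c ≤ᵇ c′) ∧ (cs ≤ᵛ cs′)

  _≤ⁿ_ : ∀ {k} → Normal k → Normal k → Bool
  (c , cs) ≤ⁿ (c′ , cs′) = (c ≤ᵇ c′) ∧ (cs ≤ᵛ cs′)

  dot-mono : ∀ {k} (cs cs′ ρ : Vec ℕ k) → Bool.T (cs ≤ᵛ cs′) → dot cs ρ ≤ dot cs′ ρ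
  dot-mono []       []         []      _ = z≤n
  dot-mono (c ∷ cs) (c′ ∷ cs′) (x ∷ ρ) h with Equivalence.to T-∧ h
  ... | h₁ , h₂ = +-mono-≤ (*-monoˡ-≤ x (≤ᵇ⇒≤ c c′ h₁)) (dot-mono cs cs′ ρ h₂)

  value-mono : ∀ {k} (p q : Normal k) ρ → Bool.T (p ≤ⁿ q) → value p ρ ≤ value q ρ
  value-mono (c , cs) (c′ , cs′) ρ h with Equivalence.to T-∧ h
  ... | h₁ , h₂ = +-mono-≤ (≤ᵇ⇒≤ c c′ h₁) (dot-mono cs cs′ ρ h₂)

  -- p and q accumulate the combined left- and right-hand sides of the hypotheses.
  certified : ∀ {k} → Normal k → Normal k → Problem k → Bool
  certified p q ([] ⊢ (l ≼ r))               = (q +ⁿ normal l) ≤ⁿ (p +ⁿ normal r)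
  certified p q (((m ∙ (l ≼ r)) ∷ hs) ⊢ g) = certified (p +ⁿ (m *ⁿ normal l)) (q +ⁿ (m *ⁿ normal r)) (hs ⊢ g)

  certified-valid : ∀ {k} (p q : Normal k) (P : Problem k) ρ →
                    Bool.T (certified p q P) → value p ρ ≤ value q ρ → Valid P ρ
  certified-valid p q ([] ⊢ (l ≼ r)) ρ ok p≤q = +-cancelˡ-≤ (value q ρ) _ _ (begin
    value q ρ + ⟦ l ⟧ ρ           ≡⟨ cong (value q ρ +_) (normal-correct l ρ) ⟨
    value q ρ + value (normal l) ρ ≡⟨ value-+ q (normal l) ρ ⟨
    value (q +ⁿ normal l) ρ       ≤⟨ value-mono (q +ⁿ normal l) (p +ⁿ normal r) ρ ok ⟩
    value (p +ⁿ normal r) ρ       ≡⟨ value-+ p (normal r) ρ ⟩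
    value p ρ + value (normal r) ρ ≡⟨ cong (value p ρ +_) (normal-correct r ρ) ⟩
    value p ρ + ⟦ r ⟧ ρ           ≤⟨ +-monoˡ-≤ (⟦ r ⟧ ρ) p≤q ⟩
    value q ρ + ⟦ r ⟧ ρ           ∎)
    where open ≤-Reasoning
  certified-valid p q (((m ∙ (l ≼ r)) ∷ hs) ⊢ g) ρ ok p≤q l≤r =
    certified-valid (p +ⁿ (m *ⁿ normal l)) (q +ⁿ (m *ⁿ normal r)) (hs ⊢ g) ρ ok (begin
      value (p +ⁿ (m *ⁿ normal l)) ρ        ≡⟨ value-+ p (m *ⁿ normal l) ρ ⟩
      value p ρ + value (m *ⁿ normal l) ρ   ≡⟨ cong (value p ρ +_) (scaled l) ⟩
      value p ρ + m * ⟦ l ⟧ ρ               ≤⟨ +-mono-≤ p≤q (*-monoʳ-≤ m l≤r) ⟩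
      value q ρ + m * ⟦ r ⟧ ρ               ≡⟨ cong (value q ρ +_) (scaled r) ⟨
      value q ρ + value (m *ⁿ normal r) ρ   ≡⟨ value-+ q (m *ⁿ normal r) ρ ⟨
      value (q +ⁿ (m *ⁿ normal r)) ρ        ∎)
    where
    open ≤-Reasoning
    scaled : ∀ e → value (m *ⁿ normal e) ρ ≡ m * ⟦ e ⟧ ρ
    scaled e = trans (value-* m (normal e) ρ) (cong (m *_) (normal-correct e ρ))

-- Coefficients and multipliers are numerals, so the check behind `ok` computes to the unit type and
-- the implicit argument is filled in without a proof. The entries of `ρ` may be arbitrary numbers,
-- products included.
linear : ∀ k (f : N-ary k (Lin k) (Problem k)) (let P = f $ⁿ Vec.map var (Vec.allFin k)) →
         {Bool.T (certified (0 , Vec.replicate k 0) (0 , Vec.replicate k 0) P)} → ∀ ρ → Valid P ρ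
linear k f {ok} ρ = certified-valid _ _ (f $ⁿ Vec.map var (Vec.allFin k)) ρ ok ≤-refl

-- Numerical estimates

-- `linear` sees products only as variables; this lemma and the next carry a linear inequality to
-- products with a common factor x and back.
multiply : ∀ m k x {a b} → m * a ≤ k * b → m * (x * a) ≤ k * (x * b)
multiply m k x {a} {b} le = subst₂ _≤_ (x∙yz≈y∙xz x m a) (x∙yz≈y∙xz x k b) (*-monoʳ-≤ x le)

divide : ∀ m k x .{{_ : NonZero x}} {a b} → m * (x * a) ≤ k * (x * b) → m * a ≤ k * b
divide m k x {a} {b} le = *-cancelˡ-≤ x (subst₂ _≤_ (x∙yz≈y∙xz m x a) (x∙yz≈y∙xz k x b) le)

-- From g ≥ 11d/13 the two products give h ≤ 13d/11 and e ≤ 2h/11, hence e ≤ 26d/121 < 2d/9.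
exceptional-arith : ∀ {h e g f d} → h * g ≤ d * d → e * g ≤ h * f → 13 * f ≤ 2 * d → g + f ≡ d → 1 ≤ d → 9 * e ≤ 2 * d
exceptional-arith {h} {e} {g} {f} {d} hg≤dd eg≤hf 13f≤2d g+f≡d 1≤d = *-cancelˡ-≤ 121 (linear 3 (λ h e d →
  99 ∙ 11 :* e ≼ 2 :* h ∷ 18 ∙ 11 :* h ≼ 13 :* d ∷ [] ⊢ 121 :* 9 :* e ≼ 121 :* 2 :* d) (h ∷ e ∷ d ∷ []) 11e≤2h 11h≤13d)
  where
  instance _ = >-nonZero 1≤d
  11d≤13g : 11 * d ≤ 13 * g
  11d≤13g = linear 3 (λ g f d → 13 ∙ d ≼ g :+ f ∷ 1 ∙ 13 :* f ≼ 2 :* d ∷ [] ⊢ 11 :* d ≼ 13 :* g)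
    (g ∷ f ∷ d ∷ []) (≤-reflexive (sym g+f≡d)) 13f≤2d
  11h≤13d : 11 * h ≤ 13 * d
  11h≤13d = divide 11 13 d (linear 4 (λ dh hd hg dd →
    11 ∙ dh ≼ hd ∷ 1 ∙ 11 :* hd ≼ 13 :* hg ∷ 13 ∙ hg ≼ dd ∷ [] ⊢ 11 :* dh ≼ 13 :* dd)
    (d * h ∷ h * d ∷ h * g ∷ d * d ∷ []) (≤-reflexive (*-comm d h)) (multiply 11 13 h 11d≤13g) hg≤dd)
  11e≤2h : 11 * e ≤ 2 * h
  11e≤2h = divide 11 2 d (linear 6 (λ de ed eg hf hd dh →
    11 ∙ de ≼ ed ∷ 1 ∙ 11 :* ed ≼ 13 :* eg ∷ 13 ∙ eg ≼ hf ∷ 1 ∙ 13 :* hf ≼ 2 :* hd ∷ 2 ∙ hd ≼ dh ∷ [] ⊢ 11 :* de ≼ 2 :* dh)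
    (d * e ∷ e * d ∷ e * g ∷ h * f ∷ h * d ∷ d * h ∷ [])
    (≤-reflexive (*-comm d e)) (multiply 11 13 e 11d≤13g) eg≤hf (multiply 13 2 h 13f≤2d) (≤-reflexive (*-comm h d)))

-- The letter e stands for d - 1. Since u ≥ 2d/3, the product bound gives l ≤ e + te/u ≤ e + 3t/2,
-- and x ≤ (l - 1)/2 then limits d.
closed-set-arith : ∀ {l x e a r t f u} → 1 + e ≤ r + t + f + x → 2 * x + 1 ≤ l → l * u ≤ a * e → a ≡ u + t →
             1 + e ≤ a + r → 3 * (r + t) ≤ 1 + e → 2 * (1 + e) + 4 ≤ 4 * r + 7 * t + 4 * f
closed-set-arith {l} {x} {e} {a} {r} {t} {f} {u} deg min bound refl size small = linear 6 (λ l x e r t f →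
  4 ∙ con 1 :+ e ≼ r :+ t :+ f :+ x ∷ 2 ∙ 2 :* x :+ con 1 ≼ l ∷ 1 ∙ 2 :* l ≼ 2 :* e :+ 3 :* t ∷ [] ⊢
  2 :* (con 1 :+ e) :+ con 4 ≼ 4 :* r :+ 7 :* t :+ 4 :* f) (l ∷ x ∷ e ∷ r ∷ t ∷ f ∷ []) deg min 2l≤2e+3t
  where
  2d≤3u : 2 * (1 + e) ≤ 3 * u
  2d≤3u = linear 4 (λ e r t u → 3 ∙ con 1 :+ e ≼ u :+ t :+ r ∷ 1 ∙ 3 :* (r :+ t) ≼ con 1 :+ e ∷ [] ⊢
    2 :* (con 1 :+ e) ≼ 3 :* u) (e ∷ r ∷ t ∷ u ∷ []) size small
  expand₁ : ∀ u e t → u * (1 + (2 * e + 3 * t)) ≡ u + 2 * (u * e) + 3 * (u * t)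
  expand₁ = solve-∀
  expand₂ : ∀ u l → u * (2 * l) ≡ 2 * (l * u)
  expand₂ = solve-∀
  expand₃ : ∀ t e → t * (2 * (1 + e)) ≡ 2 * t + 2 * (t * e)
  expand₃ = solve-∀
  expand₄ : ∀ t u → t * (3 * u) ≡ 3 * (u * t)
  expand₄ = solve-∀
  2l≤2e+3t : 2 * l ≤ 2 * e + 3 * t
  2l≤2e+3t = ≮⇒≥ λ gt → 1+n≰n {0} (linear 7 (λ e t u lu ue ut te →
    3 ∙ u :+ 2 :* ue :+ 3 :* ut ≼ 2 :* lu ∷ 6 ∙ lu ≼ ue :+ te ∷ 3 ∙ 2 :* t :+ 2 :* te ≼ 3 :* ut ∷
    1 ∙ 2 :* (con 1 :+ e) ≼ 3 :* u ∷ [] ⊢ con 1 ≼ con 0)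
    (e ∷ t ∷ u ∷ l * u ∷ u * e ∷ u * t ∷ t * e ∷ [])
    (subst₂ _≤_ (expand₁ u e t) (expand₂ u l) (*-monoʳ-≤ u gt))
    (≤-trans bound (≤-reflexive (*-distribʳ-+ e u t)))
    (subst₂ _≤_ (expand₃ t e) (expand₄ t u) (*-monoʳ-≤ t 2d≤3u))
    2d≤3u)

share-arith : ∀ {E d s fa t r} → 9 * E ≤ 2 * d → 13 * s ≤ d → fa + t ≤ s → r ≤ E + fa → 3 * (r + t) ≤ d
share-arith {E} {d} {s} {fa} {t} {r} h₁ h₂ h₃ h₄ = *-cancelˡ-≤ 39 (linear 6 (λ E d s fa t r →
  13 ∙ 9 :* E ≼ 2 :* d ∷ 9 ∙ 13 :* s ≼ d ∷ 117 ∙ fa :+ t ≼ s ∷ 117 ∙ r ≼ E :+ fa ∷ [] ⊢ 39 :* 3 :* (r :+ t) ≼ 39 :* d)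
  (E ∷ d ∷ s ∷ fa ∷ t ∷ r ∷ []) h₁ h₂ h₃ h₄)

-- Substitution bounds the left side by 8d/9 + 12s + 9 - 5t. Here 12s ≤ 12d/13, and t ≥ 1 brings the
-- constant down to 4.
room-arith : ∀ {E d s fa t r f} → 9 * E ≤ 2 * d → 13 * s ≤ d → fa + t ≤ s → r ≤ E + fa → f + 2 * t ≤ 2 * s + 2 → 1 ≤ t →
             1 + (4 * r + 7 * t + 4 * f) ≤ 2 * d + 4
room-arith {E} {d} {s} {fa} {t} {r} {f} h₁ h₂ h₃ h₄ h₅ h₆ = *-cancelˡ-≤ 9 (linear 7 (λ E d s fa t r f →
  4 ∙ 9 :* E ≼ 2 :* d ∷ 10 ∙ 13 :* s ≼ d ∷ 36 ∙ fa :+ t ≼ s ∷ 36 ∙ r ≼ E :+ fa ∷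
  36 ∙ f :+ 2 :* t ≼ 2 :* s :+ con 2 ∷ 45 ∙ con 1 ≼ t ∷ [] ⊢
  9 :* (con 1 :+ (4 :* r :+ 7 :* t :+ 4 :* f)) ≼ 9 :* (2 :* d :+ con 4))
  (E ∷ d ∷ s ∷ fa ∷ t ∷ r ∷ f ∷ []) h₁ h₂ h₃ h₄ h₅ h₆)

rest-arith : ∀ {α p m n d} → α + (p + m) ≤ n → n ≤ 3 * d → d ≤ α → d ≤ m → p ≤ d
rest-arith {α} {p} {m} {n} {d} = linear 5 (λ α p m n d →
  1 ∙ α :+ (p :+ m) ≼ n ∷ 1 ∙ n ≼ 3 :* d ∷ 1 ∙ d ≼ α ∷ 1 ∙ d ≼ m ∷ [] ⊢ p ≼ d) (α ∷ p ∷ m ∷ n ∷ d ∷ [])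


most-free : ∀ {E d s F} → d ≤ E + F → 9 * E ≤ 2 * d → 13 * s ≤ d → 1 ≤ s → s < F
most-free {E} {d} {s} {F} h₁ h₂ h₃ h₄ = *-cancelˡ-≤ 117 (linear 4 (λ E d s F →
  117 ∙ d ≼ E :+ F ∷ 13 ∙ 9 :* E ≼ 2 :* d ∷ 91 ∙ 13 :* s ≼ d ∷ 1066 ∙ con 1 ≼ s ∷ [] ⊢ 117 :* (con 1 :+ s) ≼ 117 :* F)
  (E ∷ d ∷ s ∷ F ∷ []) h₁ h₂ h₃ h₄)

spread-arith : ∀ {o m p w ξ d} → 2 * o + 1 ≤ m → m ≤ p → d ≤ p → d ≤ o + w → p + w ≤ ξ → 3 * d + 1 ≤ 2 * ξ
spread-arith {o} {m} {p} {w} {ξ} {d} = linear 6 (λ o m p w ξ d →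
  1 ∙ 2 :* o :+ con 1 ≼ m ∷ 1 ∙ m ≼ p ∷ 1 ∙ d ≼ p ∷ 2 ∙ d ≼ o :+ w ∷ 2 ∙ p :+ w ≼ ξ ∷ [] ⊢
  3 :* d :+ con 1 ≼ 2 :* ξ) (o ∷ m ∷ p ∷ w ∷ ξ ∷ d ∷ [])

-- The hypotheses give 2ξ ≥ 4d - 6, which is at least 3d + 1 from d = 7 on.
sink-arith : ∀ {p w ξ d} → 7 ≤ d → d ≤ p → d ≤ 3 + w → p + w ≤ ξ → 3 * d + 1 ≤ 2 * ξ
sink-arith {p} {w} {ξ} {d} = linear 4 (λ p w ξ d →
  1 ∙ con 7 ≼ d ∷ 2 ∙ d ≼ p ∷ 2 ∙ d ≼ con 3 :+ w ∷ 2 ∙ p :+ w ≼ ξ ∷ [] ⊢ 3 :* d :+ con 1 ≼ 2 :* ξ)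
  (p ∷ w ∷ ξ ∷ d ∷ [])

overlap-arith : ∀ {ξ ψ d n} → 3 * d + 1 ≤ 2 * ξ → 3 * d + 1 ≤ 2 * ψ → n ≤ 3 * d → n < ξ + ψ
overlap-arith {ξ} {ψ} {d} {n} h₁ h₂ h₃ = *-cancelˡ-≤ 2 (linear 4 (λ ξ ψ d n →
  1 ∙ 3 :* d :+ con 1 ≼ 2 :* ξ ∷ 1 ∙ 3 :* d :+ con 1 ≼ 2 :* ψ ∷ 2 ∙ n ≼ 3 :* d ∷ [] ⊢
  2 :* (con 1 :+ n) ≼ 2 :* (ξ :+ ψ)) (ξ ∷ ψ ∷ d ∷ n ∷ []) h₁ h₂ h₃)

grow-arith : ∀ {o m w q d f} → 2 * o + 1 ≤ m → d ≤ f + o + w → m + w ≤ q → m + 2 * d + 1 ≤ 2 * q + 2 * f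
grow-arith {o} {m} {w} {q} {d} {f} = linear 6 (λ o m w q d f →
  1 ∙ 2 :* o :+ con 1 ≼ m ∷ 2 ∙ d ≼ f :+ o :+ w ∷ 2 ∙ m :+ w ≼ q ∷ [] ⊢ m :+ 2 :* d :+ con 1 ≼ 2 :* q :+ 2 :* f)
  (o ∷ m ∷ w ∷ q ∷ d ∷ f ∷ [])

radius₂-arith : ∀ {r₁ r₂ d f} → d ≤ r₁ + f → r₁ + 2 * d + 1 ≤ 2 * r₂ + 2 * f → 3 * d + 1 ≤ 2 * r₂ + 3 * f
radius₂-arith {r₁} {r₂} {d} {f} = linear 4 (λ r₁ r₂ d f →
  1 ∙ d ≼ r₁ :+ f ∷ 1 ∙ r₁ :+ 2 :* d :+ con 1 ≼ 2 :* r₂ :+ 2 :* f ∷ [] ⊢ 3 :* d :+ con 1 ≼ 2 :* r₂ :+ 3 :* f)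
  (r₁ ∷ r₂ ∷ d ∷ f ∷ [])

radius₃-arith : ∀ {r₂ r₃ d f} → 3 * d + 1 ≤ 2 * r₂ + 3 * f → r₂ + 2 * d + 1 ≤ 2 * r₃ + 2 * f → 7 * d + 3 ≤ 4 * r₃ + 7 * f
radius₃-arith {r₂} {r₃} {d} {f} = linear 4 (λ r₂ r₃ d f →
  1 ∙ 3 :* d :+ con 1 ≼ 2 :* r₂ :+ 3 :* f ∷ 2 ∙ r₂ :+ 2 :* d :+ con 1 ≼ 2 :* r₃ :+ 2 :* f ∷ [] ⊢
  7 :* d :+ con 3 ≼ 4 :* r₃ :+ 7 :* f) (r₂ ∷ r₃ ∷ d ∷ f ∷ [])

-- Together p and q are at least (14d + 6 - 14f)/4; adding f gives more than 3d because 10f ≤ 2d.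
meet₃₃-arith : ∀ {p q d f n} → 7 * d + 3 ≤ 4 * p + 7 * f → 7 * d + 3 ≤ 4 * q + 7 * f → 5 * f ≤ d → n ≤ 3 * d → n < p + q + f
meet₃₃-arith {p} {q} {d} {f} {n} h₁ h₂ h₃ h₄ = *-cancelˡ-≤ 4 (linear 5 (λ p q d f n →
  1 ∙ 7 :* d :+ con 3 ≼ 4 :* p :+ 7 :* f ∷ 1 ∙ 7 :* d :+ con 3 ≼ 4 :* q :+ 7 :* f ∷ 2 ∙ 5 :* f ≼ d ∷ 4 ∙ n ≼ 3 :* d ∷ [] ⊢
  4 :* (con 1 :+ n) ≼ 4 :* (p :+ q :+ f)) (p ∷ q ∷ d ∷ f ∷ n ∷ []) h₁ h₂ h₃ h₄)

meet₂₂-arith : ∀ {p q d f n} → 2 * d ≤ p + 2 * f → 3 * d + 1 ≤ 2 * q + 3 * f → 5 * f ≤ d → n ≤ 3 * d → n < p + q + f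
meet₂₂-arith {p} {q} {d} {f} {n} h₁ h₂ h₃ h₄ = *-cancelˡ-< 2 n (p + q + f) (linear 5 (λ p q d f n →
  2 ∙ 2 :* d ≼ p :+ 2 :* f ∷ 1 ∙ 3 :* d :+ con 1 ≼ 2 :* q :+ 3 :* f ∷ 1 ∙ 5 :* f ≼ d ∷ 2 ∙ n ≼ 3 :* d ∷ [] ⊢
  con 1 :+ 2 :* n ≼ 2 :* (p :+ q :+ f)) (p ∷ q ∷ d ∷ f ∷ n ∷ []) h₁ h₂ h₃ h₄)

wide-arith : ∀ {r₁ r₂ w d f} → d ≤ r₁ + f → d ≤ f + w → r₁ + w ≤ r₂ → 2 * d ≤ r₂ + 2 * f
wide-arith {r₁} {r₂} {w} {d} {f} = linear 5 (λ r₁ r₂ w d f →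
  1 ∙ d ≼ r₁ :+ f ∷ 1 ∙ d ≼ f :+ w ∷ 1 ∙ r₁ :+ w ≼ r₂ ∷ [] ⊢ 2 :* d ≼ r₂ :+ 2 :* f) (r₁ ∷ r₂ ∷ w ∷ d ∷ f ∷ [])

shorter-arith : ∀ {l d} → 1 ≤ l → 5 * l ≤ d → l < d
shorter-arith {l} {d} = linear 2 (λ l d → 1 ∙ con 1 ≼ l ∷ 1 ∙ 5 :* l ≼ d ∷ [] ⊢ con 1 :+ l ≼ d) (l ∷ d ∷ [])

enough-arith : ∀ {j d} → 5 * (6 + 3 * j) ≤ d → 8 + 3 * j ≤ d
enough-arith {j} {d} = linear 2 (λ j d → 1 ∙ 5 :* (con 6 :+ 3 :* j) ≼ d ∷ [] ⊢ con 8 :+ 3 :* j ≼ d) (j ∷ d ∷ [])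

thirteen-arith : ∀ {i d} → 45 * (4 + i) ≤ 8 + 3 * d → 13 * (3 + i) ≤ d
thirteen-arith {i} {d} h = *-cancelˡ-≤ 3 (linear 2 (λ i d → 1 ∙ 45 :* (con 4 :+ i) ≼ con 8 :+ 3 :* d ∷ [] ⊢
  3 :* 13 :* (con 3 :+ i) ≼ 3 :* d) (i ∷ d ∷ []) h)

fifteen-arith : ∀ {i d} → 45 * (4 + i) ≤ 8 + 3 * d → 5 * (6 + 3 * suc i) ≤ d
fifteen-arith {i} {d} h = *-cancelˡ-≤ 3 (linear 2 (λ i d → 1 ∙ 45 :* (con 4 :+ i) ≼ con 8 :+ 3 :* d ∷ [] ⊢
  3 :* 5 :* (con 6 :+ 3 :* (con 1 :+ i)) ≼ 3 :* d) (i ∷ d ∷ []) h)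

-- Counting

private variable
  n : ℕ
  P Q R : Pred (Fin n) 0ℓ

ind : {X : Set} → Dec X → ℕ
ind p = if does p then 1 else 0

opaque
  # : Decidable P → ℕ
  # P? = sum (ind ∘ P?)

sum-mono : {f g : Fin n → ℕ} → (∀ i → f i ≤ g i) → sum f ≤ sum g
sum-mono {zero}  f≤g = z≤n
sum-mono {suc n} f≤g = +-mono-≤ (f≤g zero) (sum-mono (f≤g ∘ suc))

opaque
  unfolding #

  #-mono : (P? : Decidable P) (Q? : Decidable Q) → (∀ {x} → P x → Q x) → # P? ≤ # Q?
  #-mono P? Q? P⊆Q = sum-mono λ i → pointwise (P? i) (Q? i) P⊆Q
    where
    pointwise : {X Y : Set} (p : Dec X) (q : Dec Y) → (X → Y) → ind p ≤ ind q
    pointwise (yes x) (yes y) f = ≤-refl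
    pointwise (yes x) (no ¬y) f = contradiction (f x) ¬y
    pointwise (no ¬x) q       f = z≤n

  #-cover : (R? : Decidable R) (P? : Decidable P) (Q? : Decidable Q) →
            (∀ {x} → R x → P x ⊎ Q x) → # R? ≤ # P? + # Q?
  #-cover R? P? Q? R⊆P∪Q =
    ≤-trans (sum-mono λ i → pointwise (R? i) (P? i) (Q? i) R⊆P∪Q) (≤-reflexive (∑-distrib-+ (ind ∘ P?) (ind ∘ Q?)))
    where
    pointwise : {X Y Z : Set} (r : Dec Z) (p : Dec X) (q : Dec Y) → (Z → X ⊎ Y) → ind r ≤ ind p + ind q
    pointwise (no _)  p       q       f = z≤n
    pointwise (yes z) (yes _) q       f = s≤s z≤n
    pointwise (yes z) (no ¬x) (yes _) f = ≤-refl
    pointwise (yes z) (no ¬x) (no ¬y) f = ⊥-elim ([ ¬x , ¬y ]′ (f z))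

  #-disjoint : (R? : Decidable R) (P? : Decidable P) (Q? : Decidable Q) →
               (∀ {x} → P x → R x) → (∀ {x} → Q x → R x) → (∀ {x} → P x → Q x → ⊥) →
               # P? + # Q? ≤ # R?
  #-disjoint R? P? Q? P⊆R Q⊆R P∥Q =
    ≤-trans (≤-reflexive (sym (∑-distrib-+ (ind ∘ P?) (ind ∘ Q?))))
            (sum-mono λ i → pointwise (R? i) (P? i) (Q? i) P⊆R Q⊆R P∥Q)
    where
    pointwise : {X Y Z : Set} (r : Dec Z) (p : Dec X) (q : Dec Y) →
                (X → Z) → (Y → Z) → (X → Y → ⊥) → ind p + ind q ≤ ind r
    pointwise r       (yes x) (yes y) f g h = ⊥-elim (h x y)
    pointwise (yes _) (yes x) (no _)  f g h = ≤-refl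
    pointwise (no ¬z) (yes x) (no _)  f g h = contradiction (f x) ¬z
    pointwise (yes _) (no _)  (yes y) f g h = ≤-refl
    pointwise (no ¬z) (no _)  (yes y) f g h = contradiction (g y) ¬z
    pointwise r       (no _)  (no _)  f g h = z≤n

  #-empty : ∀ {n} {P : Pred (Fin n) 0ℓ} (P? : Decidable P) → (∀ {x} → ¬ P x) → # P? ≡ 0
  #-empty {n = zero}  P? ¬P = refl
  #-empty {n = suc n} P? ¬P with P? zero
  ... | yes p = contradiction p ¬P
  ... | no  _ = #-empty (P? ∘ suc) ¬P

  #-full : ∀ {n} {P : Pred (Fin n) 0ℓ} (P? : Decidable P) → # P? ≤ n
  #-full {n = zero}  P? = z≤n
  #-full {n = suc n} P? with P? zero
  ... | yes _ = s≤s (#-full (P? ∘ suc))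
  ... | no  _ = m≤n⇒m≤1+n (#-full (P? ∘ suc))

#-witness : (P? : Decidable P) → 1 ≤ # P? → ∃[ x ] P x
#-witness P? 1≤# with any? P?
... | yes p = p
... | no ¬p = contradiction (#-empty P? (λ {x} px → ¬p (x , px))) (>⇒≢ 1≤#)

#-meet : (R? : Decidable R) (P? : Decidable P) (Q? : Decidable Q) →
         (∀ {x} → P x → R x) → (∀ {x} → Q x → R x) → # R? < # P? + # Q? → ∃[ x ] P x × Q x
#-meet R? P? Q? P⊆R Q⊆R lt with any? (λ x → P? x ×-dec Q? x)
... | yes w = w
... | no ¬w = contradiction (#-disjoint R? P? Q? P⊆R Q⊆R (λ {x} p q → ¬w (x , p , q))) (<⇒≱ lt)

#-diff : ∀ {n} {P Q : Pred (Fin n) 0ℓ} (P? : Decidable P) (Q? : Decidable Q) → # Q? < # P? → ∃[ x ] P x × ¬ Q x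
#-diff {P = P} {Q} P? Q? lt with any? (λ x → P? x ×-dec ¬? (Q? x))
... | yes w = w
... | no ¬w = contradiction (#-mono P? Q? P⊆Q) (<⇒≱ lt)
  where
  P⊆Q : ∀ {x} → P x → Q x
  P⊆Q {x} p with Q? x
  ... | yes q = q
  ... | no ¬q = contradiction (x , p , ¬q) ¬w

opaque
  unfolding #

  #-singleton : (x : Fin n) → # (_≟ x) ≡ 1
  #-singleton {suc n} zero    = cong suc (#-empty {n = n} (λ i → suc i ≟ zero) λ ())
  #-singleton {suc n} (suc x) = trans
    (≤-antisym (#-mono (λ i → suc i ≟ suc x) (_≟ x) λ { refl → refl }) (#-mono (_≟ x) (λ i → suc i ≟ suc x) (cong suc)))
    (#-singleton x)

_∈?_ : (x : Fin n) (xs : List (Fin n)) → Dec (x ∈ xs)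
x ∈? xs = DecMembership._∈?_ _≟_ x xs

#-list≤ : ∀ {n} (xs : List (Fin n)) → # (_∈? xs) ≤ length xs
#-list≤ {n} []   = ≤-reflexive (#-empty {P = λ (x : Fin n) → x ∈ []} (_∈? []) λ ())
#-list≤ (x ∷ xs) = ≤-trans
  (#-cover (_∈? (x ∷ xs)) (_≟ x) (_∈? xs) λ { (here eq) → inj₁ eq ; (there m) → inj₂ m })
  (+-mono-≤ (≤-reflexive (#-singleton x)) (#-list≤ xs))

#-list≥ : {xs : List (Fin n)} → Unique xs → length xs ≤ # (_∈? xs)
#-list≥ []                     = z≤n
#-list≥ {xs = x ∷ xs} (x∉ ∷ u) = ≤-trans
  (+-mono-≤ (≤-reflexive (sym (#-singleton x))) (#-list≥ u))
  (#-disjoint (_∈? (x ∷ xs)) (_≟ x) (_∈? xs) here there λ { refl m → All.lookup x∉ m refl })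

#-avoid : (P? : Decidable P) (xs : List (Fin n)) → length xs < # P? → ∃[ x ] P x × x ∉ xs
#-avoid P? xs lt = #-diff P? (_∈? xs) (≤-<-trans (#-list≤ xs) lt)

#-inhabited : (P? : Decidable P) {x : Fin n} → P x → 1 ≤ # P?
#-inhabited P? {x} px = ≤-trans (≤-reflexive (sym (#-singleton x))) (#-mono (_≟ x) P? λ { refl → px })

opaque
  unfolding #

  -- The pairs x, y with `P x`, `Q y` and `R x y` are counted by rows and by columns.
  double-count : ∀ {n} {P Q : Pred (Fin n) 0ℓ} {R : Fin n → Fin n → Set} (P? : Decidable P) (Q? : Decidable Q)
                 (R? : ∀ x y → Dec (R x y)) {k l : ℕ} →
                 (∀ {x} → P x → k ≤ # (λ y → Q? y ×-dec R? x y)) →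
                 (∀ {y} → Q y → # (λ x → P? x ×-dec R? x y) ≤ l) →
                 # P? * k ≤ # Q? * l
  double-count {n} {P} {Q} P? Q? R? {k} {l} lower upper = begin
    # P? * k                                                    ≡⟨ *-distribʳ-sum k (ind ∘ P?) ⟩
    sum (λ x → ind (P? x) * k)                                  ≤⟨ sum-mono (λ x → rows x (P? x) lower) ⟩
    sum (λ x → sum (λ y → ind (P? x ×-dec (Q? y ×-dec R? x y))))  ≡⟨ ∑-comm (λ x y → ind (P? x ×-dec (Q? y ×-dec R? x y))) ⟩
    sum (λ y → sum (λ x → ind (P? x ×-dec (Q? y ×-dec R? x y))))  ≤⟨ sum-mono (λ y → columns y (Q? y) upper) ⟩
    sum (λ y → ind (Q? y) * l)                                  ≡⟨ *-distribʳ-sum l (ind ∘ Q?) ⟨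
    # Q? * l                                                    ∎
    where
    open ≤-Reasoning
    -- The decision `p` is a separate argument so that a case split on it also computes inside the
    -- count.
    rows : ∀ x → (p : Dec (P x)) → (∀ {x} → P x → k ≤ # (λ y → Q? y ×-dec R? x y)) →
           ind p * k ≤ # (λ y → p ×-dec (Q? y ×-dec R? x y))
    rows x (no _)  low = z≤n
    rows x (yes p) low = ≤-trans (≤-reflexive (+-identityʳ k))
      (≤-trans (low p) (#-mono (λ y → Q? y ×-dec R? x y) (λ y → yes p ×-dec (Q? y ×-dec R? x y)) (p ,_)))
    columns : ∀ y → (q : Dec (Q y)) → (∀ {y} → Q y → # (λ x → P? x ×-dec R? x y) ≤ l) →
              # (λ x → P? x ×-dec (q ×-dec R? x y)) ≤ ind q * l
    columns y (no ¬q) up = ≤-reflexive (#-empty (λ x → P? x ×-dec (no ¬q ×-dec R? x y)) λ { (_ , q , _) → ¬q q })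
    columns y (yes q) up = ≤-trans
      (#-mono (λ x → P? x ×-dec (yes q ×-dec R? x y)) (λ x → P? x ×-dec R? x y) λ { (p , _ , r) → p , r })
      (≤-trans (up q) (≤-reflexive (sym (+-identityʳ l))))

-- Walks and cycles

-- Walk R x xs y lists the vertices of a walk from x to y, the endpoint y
-- excluded; so length xs is its number of arcs, and a cycle through x is a
-- Walk R x xs x with Unique xs.
data Walk {V : Set} (R : Rel V 0ℓ) : V → List V → V → Set where
  []  : ∀ {x} → Walk R x [] x
  _∷_ : ∀ {x y z ys} → R x y → Walk R y ys z → Walk R x (x ∷ ys) z

module _ {V : Set} {R : Rel V 0ℓ} where

  _++ʷ_ : ∀ {x y z xs ys} → Walk R x xs y → Walk R y ys z → Walk R x (xs ++ ys) z
  []      ++ʷ w′ = w′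
  (r ∷ w) ++ʷ w′ = r ∷ (w ++ʷ w′)

module _ {V : Set} {R : Rel V 0ℓ} where

  -- As the lists omit the endpoint, reversal exchanges x with y and reverses only the interior.
  reverseʷ : ∀ {x y xs} → Walk R x (x ∷ xs) y → Walk (flip R) y (y ∷ reverse xs) x
  reverseʷ (r ∷ [])                              = r ∷ []
  reverseʷ {y = y} (_∷_ {y = x′} r w@(_∷_ {ys = xs} _ _)) =
    subst (λ l → Walk (flip R) y (y ∷ l) _) (sym (unfold-reverse x′ xs)) (reverseʷ w ++ʷ (r ∷ []))

  mapʷ : ∀ {S : Rel V 0ℓ} {x y xs} → (∀ {x y} → R x y → S x y) → Walk R x xs y → Walk S x xs y
  mapʷ f []      = []
  mapʷ f (r ∷ w) = f r ∷ mapʷ f w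

  sources : ∀ {P : V → Set} {x y xs} → (∀ {x y} → R x y → P x) → Walk R x xs y → All P xs
  sources f []      = []
  sources f (r ∷ w) = f r ∷ sources f w

  lookup-next : ∀ {x y xs} → Walk R x xs y → ∀ i j → toℕ j ≡ suc (toℕ i) → R (lookup xs i) (lookup xs j)
  lookup-next (r ∷ [])      zero    (suc ()) eq
  lookup-next (r ∷ _ ∷ _)   zero    (suc zero) eq = r
  lookup-next (r ∷ w)       (suc i) (suc j) eq = lookup-next w i j (suc-injective eq)

  lookup-last : ∀ {x y xs} → Walk R x xs y → ∀ i → suc (toℕ i) ≡ length xs → R (lookup xs i) y
  lookup-last (r ∷ [])          zero    eq = r
  lookup-last (r ∷ (_ ∷ _))     zero    ()
  lookup-last (r ∷ w@(_ ∷ _))   (suc i) eq = lookup-last w i (suc-injective eq)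

module _ {n : ℕ} {R : Rel (Fin n) 0ℓ} where

  Path : Fin n → Fin n → ℕ → Set
  Path x y k = ∃[ xs ] Walk R x xs y × Unique xs × y ∉ xs × length xs ≤ k

  dropTo : ∀ {x y z k xs} → z ∈ xs → Walk R x xs y → Unique xs → y ∉ xs → length xs ≤ k → Path z y k
  dropTo (here refl) w@(_ ∷ _) u       y∉ l≤k = _ , w , u , y∉ , l≤k
  dropTo (there z∈)  (r ∷ w) (_ ∷ u) y∉ l≤k = dropTo z∈ w u (y∉ ∘ there) (≤-trans (n≤1+n _) l≤k)

  -- Loops are removed from the end of the walk: if x recurs in the part already made simple,
  -- `dropTo` restarts at that occurrence.
  erase : ∀ {x y k xs} → Walk R x xs y → length xs ≤ k → Path x y k
  erase [] l≤k = [] , [] , [] , (λ ()) , z≤n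
  erase {x} {y} (r ∷ w) (s≤s l≤k) with erase w l≤k
  ... | ys , w′ , u , y∉ , l′ with x ≟ y | x ∈? ys
  ... | yes refl | _     = [] , [] , [] , (λ ()) , z≤n
  ... | no x≢y   | yes m = dropTo m w′ u y∉ (≤-trans l′ (n≤1+n _))
  ... | no x≢y   | no x∉ = _ , r ∷ w′ , All.¬Any⇒All¬ ys x∉ ∷ u , (λ { (here eq) → x≢y (sym eq) ; (there m) → y∉ m }) , s≤s l′

-- Cycles through a vertex, and reversal of all arcs

OnCycle : OrientedGraph n → Fin n → ℕ → Set
OnCycle G v ℓ = ∃[ xs ] Walk (OrientedGraph._⟶_ G) v (v ∷ xs) v × Unique (v ∷ xs) × suc (length xs) ≡ ℓ

lookup-injective : ∀ {V : Set} {xs : List V} → Unique xs → ∀ {i j} → lookup xs i ≡ lookup xs j → i ≡ j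
lookup-injective {xs = x ∷ xs} (p ∷ u) {zero}  {zero}  eq = refl
lookup-injective {xs = x ∷ xs} (p ∷ u) {zero}  {suc j} eq = contradiction eq (All.lookup p (∈-lookup j))
lookup-injective {xs = x ∷ xs} (p ∷ u) {suc i} {zero}  eq = contradiction (sym eq) (All.lookup p (∈-lookup i))
lookup-injective {xs = x ∷ xs} (p ∷ u) {suc i} {suc j} eq = cong suc (lookup-injective u eq)

toℕ-next : ∀ {k} (i : Fin (suc k)) → toℕ (next i) ≡ suc (toℕ i) % suc k
toℕ-next i = toℕ-fromℕ< _

cycleCopy : {G : OrientedGraph n} {v : Fin n} {ℓ : ℕ} → OnCycle G v ℓ → ∃[ C ] LiesOn {ℓ = ℓ} {G = G} v C
cycleCopy {G = G} {v} (xs , w , u , refl) = record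
  { vertex    = lookup (v ∷ xs)
  ; injective = lookup-injective u
  ; arc       = arc
  } , zero , refl
  where
  open OrientedGraph G
  arc : ∀ i → lookup (v ∷ xs) i ⟶ lookup (v ∷ xs) (next i)
  arc i with m≤n⇒m<n∨m≡n (toℕ<n i)
  ... | inj₁ lt = lookup-next w i (next i) (trans (toℕ-next i) (m<n⇒m%n≡m lt))
  -- At the last index `next` wraps around to `zero`, and the last arc of the walk ends at v.
  ... | inj₂ eq = subst (λ j → lookup (v ∷ xs) i ⟶ lookup (v ∷ xs) j)
                        (sym (toℕ-injective {j = zero} (trans (toℕ-next i) (trans (cong (_% suc (length xs)) eq) (n%n≡0 (suc (length xs)))))))
                        (lookup-last w i eq)

_ᵒᵖ : OrientedGraph n → OrientedGraph n
G ᵒᵖ = record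
  { _⟶_    = λ x y → y ⟶ x
  ; _⟶?_   = λ x y → y ⟶? x
  ; irrefl = λ eq → irrefl (sym eq)
  ; asym   = asym
  }
  where open OrientedGraph G

unique-reverse : ∀ {V : Set} {x : V} {xs : List V} → Unique (x ∷ xs) → Unique (x ∷ reverse xs)
unique-reverse {V} {x} {xs} (x∉ ∷ u) =
  All.tabulate (λ m → All.lookup x∉ (Any.reverse⁻ m)) ∷
  Permutation.Unique-resp-↭ (setoid V) (↭⇒↭ₛ (↭-sym (↭-reverse xs))) u

onCycle-op : {G : OrientedGraph n} {v : Fin n} {ℓ : ℕ} → OnCycle (G ᵒᵖ) v ℓ → OnCycle G v ℓ
onCycle-op (xs , w , u , refl) = reverse xs , reverseʷ w , unique-reverse u , cong suc (length-reverse xs)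

-- Degrees, and vertices of small out-degree within a set

module Degrees {n : ℕ} (G : OrientedGraph n) where
  open OrientedGraph G

  deg⁺ deg⁻ : Fin n → ℕ
  deg⁺ v = # (v ⟶?_)
  deg⁻ v = # (_⟶? v)

  opaque
    unfolding #

    ∣tabulate∣ : ∀ {m} {P : Pred (Fin m) 0ℓ} (P? : Decidable P) → ∣ tabulate (does ∘ P?) ∣ ≡ # P?
    ∣tabulate∣ {zero}  P? = refl
    ∣tabulate∣ {suc m} P? with does (P? zero)
    ... | true  = cong suc (∣tabulate∣ (P? ∘ suc))
    ... | false = ∣tabulate∣ (P? ∘ suc)

  δ⁰≥⇒deg≥ : ∀ {d} → δ⁰ ≥ d → ∀ v → d ≤ deg⁺ v × d ≤ deg⁻ v
  δ⁰≥⇒deg≥ {d} δ⁰≥d v = ≤-trans d≤ (≤-trans (m⊓n≤m (d⁺ v) (d⁻ v)) (≤-reflexive (∣tabulate∣ (v ⟶?_))))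
                   , ≤-trans d≤ (≤-trans (m⊓n≤n (d⁺ v) (d⁻ v)) (≤-reflexive (∣tabulate∣ (_⟶? v))))
    where
    d≤ : d ≤ d⁺ v ⊓ d⁻ v
    d≤ = ≤-trans δ⁰≥d (min≤v⁺ n (map (λ v → d⁺ v ⊓ d⁻ v) (allFin n))
           (inj₂ (Any.map⁺ (Any.map (λ { refl → ≤-refl }) (∈-allFin v)))))

  -- The hypothesis `d ≤ n` accounts for the start value n of the minimum.
  deg≥⇒δ⁰≥ : ∀ {d} → d ≤ n → (∀ v → d ≤ deg⁺ v × d ≤ deg⁻ v) → δ⁰ ≥ d
  deg≥⇒δ⁰≥ d≤n deg≥ = v≤min⁺ {xs = map (λ v → d⁺ v ⊓ d⁻ v) (allFin n)} d≤n (All.map⁺ {xs = allFin n} (All.tabulate λ {v} _ →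
    ⊓-glb (≤-trans (proj₁ (deg≥ v)) (≤-reflexive (sym (∣tabulate∣ (v ⟶?_)))))
          (≤-trans (proj₂ (deg≥ v)) (≤-reflexive (sym (∣tabulate∣ (_⟶? v)))))))

  private
    2h<p : ∀ {p h} → 1 ≤ p → h ≤ p ∸ 1 ∸ h → 2 * h < p
    2h<p {suc p} {h} _ le = s≤s (≤-trans (+-monoʳ-≤ h (≤-reflexive (+-identityʳ h)))
      (≤-trans (+-monoˡ-≤ h le) (≤-reflexive (m∸n+n≡m (≤-trans le (m∸n≤m p h))))))

  -- Otherwise the arcs inside P would outnumber its pairs.
  min-outdegree : {P : Pred (Fin n) 0ℓ} (P? : Decidable P) → 1 ≤ # P? →
                  ∃[ x ] P x × 2 * # (λ y → P? y ×-dec (x ⟶? y)) + 1 ≤ # P?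
  min-outdegree {P} P? 1≤P with any? (λ x → P? x ×-dec (2 * # (λ y → P? y ×-dec (x ⟶? y)) + 1 ≤? # P?))
  ... | yes w = w
  ... | no ¬w = contradiction (2h<p 1≤P h≤l) (≤⇒≯ large)
    where
    p h : ℕ
    p = # P?
    -- If no vertex qualifies, every out-degree inside P is at least h, so every in-degree there is
    -- at most p - 1 - h. Counting the arcs inside P both ways gives 2h < p, whereas h is half of p
    -- rounded up.
    h = ⌈ p /2⌉
    large : p ≤ 2 * h
    large = ≤-trans (≤-reflexive (sym (⌊n/2⌋+⌈n/2⌉≡n p)))
      (≤-trans (+-monoˡ-≤ h (⌊n/2⌋≤⌈n/2⌉ p)) (≤-reflexive (cong (h +_) (sym (+-identityʳ h)))))
    out≥ : ∀ {x} → P x → h ≤ # (λ y → P? y ×-dec (x ⟶? y))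
    out≥ {x} px = ≤-trans (⌈n/2⌉-mono p≤2o) (≤-reflexive (trans (cong (λ k → ⌈ o + k /2⌉) (+-identityʳ o)) (sym (n≡⌈n+n/2⌉ o))))
      where
      o : ℕ
      o = # (λ y → P? y ×-dec (x ⟶? y))
      p≤2o : p ≤ 2 * o
      p≤2o = ≤-pred (≤-trans (≰⇒> (λ le → ¬w (x , px , le))) (≤-reflexive (+-comm (2 * o) 1)))
    in≤ : ∀ {y} → P y → # (λ x → P? x ×-dec (x ⟶? y)) ≤ p ∸ 1 ∸ h
    in≤ {y} py = m+n≤o⇒m≤o∸n i (≤-trans (+-monoʳ-≤ i (out≥ py)) (m+n≤o⇒n≤o∸m 1 1+i+o≤p))
      where
      i : ℕ
      i = # (λ x → P? x ×-dec (x ⟶? y))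
      m+n≤o⇒n≤o∸m : ∀ m {n o} → m + n ≤ o → n ≤ o ∸ m
      m+n≤o⇒n≤o∸m m {n} le = m+n≤o⇒m≤o∸n n (≤-trans (≤-reflexive (+-comm n m)) le)
      nb? : Decidable (λ x → P x × ((x ⟶ y) ⊎ (y ⟶ x)))
      nb? x = P? x ×-dec ((x ⟶? y) ⊎-dec (y ⟶? x))
      1+i+o≤p : 1 + (i + # (λ x → P? x ×-dec (y ⟶? x))) ≤ p
      1+i+o≤p = ≤-trans
        (+-mono-≤ (≤-reflexive (sym (#-singleton y)))
          (#-disjoint nb? (λ x → P? x ×-dec (x ⟶? y)) (λ x → P? x ×-dec (y ⟶? x))
            (λ { (a , b) → a , inj₁ b }) (λ { (a , b) → a , inj₂ b }) (λ { (_ , a) (_ , b) → asym a b })))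
        (#-disjoint P? (_≟ y) nb? (λ { refl → py }) proj₁
          λ { refl (_ , inj₁ a) → irrefl refl a ; refl (_ , inj₂ a) → irrefl refl a })
    h≤l : h ≤ p ∸ 1 ∸ h
    h≤l = *-cancelˡ-≤ p {{>-nonZero 1≤P}} (double-count P? P? _⟶?_ out≥ in≤)

-- Independent out-neighbourhood

module Independent {n : ℕ} (G : OrientedGraph n) (v : Fin n) {d s k : ℕ}
  (n≤3d : n ≤ 3 * d)
  (deg≥ : ∀ x → d ≤ Degrees.deg⁺ G x × d ≤ Degrees.deg⁻ G x)
  (independent : ∀ {a a′} → OrientedGraph._⟶_ G v a → OrientedGraph._⟶_ G v a′ → ¬ OrientedGraph._⟶_ G a a′)
  (s≡1+k : s ≡ suc k) (13s≤d : 13 * s ≤ d)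
  where
  open OrientedGraph G
  open Degrees G

  1≤s : 1 ≤ s
  1≤s = ≤-trans (s≤s z≤n) (≤-reflexive (sym s≡1+k))

  A : Fin n → Set
  A x = v ⟶ x
  A? : Decidable A
  A? = v ⟶?_

  1≤d : 1 ≤ d
  1≤d = ≤-trans 1≤s (≤-trans (m≤n*m s 13) 13s≤d)

  ¬Av : ¬ A v
  ¬Av = irrefl refl

  ∉A⁺ : ∀ {a w} → A a → a ⟶ w → ¬ A w
  ∉A⁺ Aa aw Aw = independent Aa Aw aw
  ∉A⁻ : ∀ {a w} → A a → w ⟶ a → ¬ A w
  ∉A⁻ Aa wa Aw = independent Aw Aa wa

  ⊤? : Decidable (λ (x : Fin n) → ⊤)
  ⊤? _ = yes tt

  nb? : ∀ a → Decidable (λ x → (a ⟶ x) ⊎ (x ⟶ a))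
  nb? a x = (a ⟶? x) ⊎-dec (x ⟶? a)

  deg≤nb : ∀ a → deg⁺ a + deg⁻ a ≤ # (nb? a)
  deg≤nb a = #-disjoint (nb? a) (a ⟶?_) (_⟶? a) inj₁ inj₂ asym

  A∥nb : ∀ {a x} → A a → A x → (a ⟶ x) ⊎ (x ⟶ a) → ⊥
  A∥nb Aa Ax = [ independent Aa Ax , independent Ax Aa ]′

  -- Independence makes A disjoint from both neighbourhoods of a. As n ≤ 3d, none of the three sets
  -- can have more than d vertices.
  total≤n : ∀ {a} → A a → deg⁺ v + (deg⁺ a + deg⁻ a) ≤ n
  total≤n {a} Aa = ≤-trans (+-monoʳ-≤ (deg⁺ v) (deg≤nb a))
    (≤-trans (#-disjoint ⊤? A? (nb? a) (λ _ → tt) (λ _ → tt) (A∥nb Aa)) (#-full ⊤?))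

  deg⁺≤d : ∀ {a} → A a → deg⁺ a ≤ d
  deg⁺≤d {a} Aa = rest-arith (total≤n Aa) n≤3d (proj₁ (deg≥ v)) (proj₂ (deg≥ a))

  deg⁻≤d : ∀ {a} → A a → deg⁻ a ≤ d
  deg⁻≤d {a} Aa = rest-arith (subst (λ k → deg⁺ v + k ≤ n) (+-comm (deg⁺ a) (deg⁻ a)) (total≤n Aa))
                             n≤3d (proj₁ (deg≥ v)) (proj₁ (deg≥ a))

  #A≤d : # A? ≤ d
  #A≤d with #-witness A? (≤-trans 1≤d (proj₁ (deg≥ v)))
  ... | a , Aa = rest-arith (≤-trans (≤-reflexive (+-comm′ (deg⁺ a) (deg⁺ v) (deg⁻ a))) (total≤n Aa))
                            n≤3d (proj₁ (deg≥ a)) (proj₂ (deg≥ a))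
    where
    +-comm′ : ∀ x y z → x + (y + z) ≡ y + (x + z)
    +-comm′ = solve-∀

  -- Otherwise A, the two neighbourhoods of a, and w would make up 3d + 1 vertices.
  adjacent : ∀ {a w} → A a → ¬ A w → (a ⟶ w) ⊎ (w ⟶ a)
  adjacent {a} {w} Aa ¬Aw with nb? a w
  ... | yes aw = aw
  ... | no ¬aw = contradiction
    (≤-trans (+-monoʳ-≤ (deg⁺ v) (≤-trans (≤-trans (+-monoˡ-≤ 1 (deg≤nb a)) (+-monoʳ-≤ (# (nb? a)) (≤-reflexive (sym (#-singleton w)))))
               (#-disjoint rest? (nb? a) (_≟ w) inj₁ inj₂ λ { x refl → ¬aw x })))
      (≤-trans (#-disjoint ⊤? A? rest? (λ _ → tt) (λ _ → tt) λ { Ax (inj₁ x) → A∥nb Aa Ax x ; Ax (inj₂ refl) → ¬Aw Ax })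
               (≤-trans (#-full ⊤?) n≤3d)))
    (λ le → 1+n≰n (excess (proj₁ (deg≥ v)) (proj₁ (deg≥ a)) (proj₂ (deg≥ a)) le))
    where
    rest? : Decidable (λ x → ((a ⟶ x) ⊎ (x ⟶ a)) ⊎ x ≡ w)
    rest? x = nb? a x ⊎-dec (x ≟ w)
    excess : ∀ {α p m} → d ≤ α → d ≤ p → d ≤ m → α + (p + m + 1) ≤ 3 * d → 1 ≤ 0
    excess {α} {p} {m} = linear 4 (λ α p m d →
      1 ∙ d ≼ α ∷ 1 ∙ d ≼ p ∷ 1 ∙ d ≼ m ∷ 1 ∙ α :+ (p :+ m :+ con 1) ≼ 3 :* d ∷ [] ⊢ con 1 ≼ con 0) (α ∷ p ∷ m ∷ d ∷ [])

  -- Otherwise every in-neighbour of v, being outside A and hence adjacent to a, sends an arc to a.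
  -- With v itself, a would have d + 1 in-neighbours.
  closing : ∀ {a} → A a → ∃[ b ] a ⟶ b × b ⟶ v
  closing {a} Aa with any? (λ b → (a ⟶? b) ×-dec (b ⟶? v))
  ... | yes w = w
  ... | no ¬w = contradiction
    (≤-trans (+-mono-≤ (≤-reflexive (sym (#-singleton v))) ≤-refl)
      (≤-trans (#-disjoint (_⟶? a) (_≟ v) (_⟶? v) (λ { refl → Aa }) into (λ { refl x → irrefl refl x })) (deg⁻≤d Aa)))
    (<⇒≱ (s≤s (proj₂ (deg≥ v))))
    where
    into : ∀ {b} → b ⟶ v → b ⟶ a
    into {b} bv with adjacent Aa (λ vb → asym vb bv)
    ... | inj₁ ab = contradiction (b , ab , bv) ¬w
    ... | inj₂ ba = ba

  outside : Fin n → ℕ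
  outside w = # (λ x → ¬? (A? x) ×-dec (x ⟶? w))

  -- A step back from a ∈ E may be impossible, because the in-neighbours of a have
  -- nearly all their in-neighbours in A.
  E Hi : Fin n → Set
  E a = A a × # (λ w → (w ⟶? a) ×-dec (suc (2 * s) ≤? outside w)) ≤ 2 * s
  Hi w = ¬ A w × outside w ≤ 2 * s

  E? : Decidable E
  E? a = A? a ×-dec (# (λ w → (w ⟶? a) ×-dec (suc (2 * s) ≤? outside w)) ≤? 2 * s)
  Hi? : Decidable Hi
  Hi? w = ¬? (A? w) ×-dec (outside w ≤? 2 * s)

  2s≤d : 2 * s ≤ d
  2s≤d = linear 2 (λ s d → 1 ∙ 13 :* s ≼ d ∷ [] ⊢ 2 :* s ≼ d) (s ∷ d ∷ []) 13s≤d

  Hi-indegree : ∀ {w} → Hi w → d ≤ # (λ a → A? a ×-dec (a ⟶? w)) + 2 * s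
  Hi-indegree {w} (_ , le) = ≤-trans (proj₂ (deg≥ w)) (≤-trans
    (#-cover (_⟶? w) (λ a → A? a ×-dec (a ⟶? w)) (λ x → ¬? (A? x) ×-dec (x ⟶? w)) split)
    (+-monoʳ-≤ _ le))
    where
    split : ∀ {x} → x ⟶ w → (A x × x ⟶ w) ⊎ (¬ A x × x ⟶ w)
    split {x} xw with A? x
    ... | yes Ax = inj₁ (Ax , xw)
    ... | no ¬Ax = inj₂ (¬Ax , xw)

  -- Double counting twice. Vertices of `Hi` receive at least d - 2s arcs from A, which bounds `Hi`
  -- and leaves each of them at most 2s arcs into `E`; yet each vertex of `E` has at least d - 2s
  -- in-neighbours in `Hi`.
  9E≤2d : 9 * # E? ≤ 2 * d
  9E≤2d = exceptional-arith {# Hi?} {# E?} {d ∸ 2 * s} {2 * s}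
    (≤-trans (double-count Hi? A? (λ w a → a ⟶? w)
        (λ hi → m≤n+o⇒m∸n≤o d (2 * s) (≤-trans (Hi-indegree hi) (≤-reflexive (+-comm _ (2 * s)))))
        (λ {a} Aa → ≤-trans (#-mono (λ w → Hi? w ×-dec (a ⟶? w)) (a ⟶?_) proj₂) (deg⁺≤d Aa)))
      (*-monoˡ-≤ d #A≤d))
    (double-count E? Hi? (λ a w → w ⟶? a) E-degree Hi-outdegree)
    (linear 2 (λ s d → 2 ∙ 13 :* s ≼ d ∷ [] ⊢ 13 :* 2 :* s ≼ 2 :* d) (s ∷ d ∷ []) 13s≤d)
    (m∸n+n≡m 2s≤d) 1≤d
    where
    E-degree : ∀ {a} → E a → d ∸ 2 * s ≤ # (λ w → Hi? w ×-dec (w ⟶? a))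
    E-degree {a} (Aa , le) = m≤n+o⇒m∸n≤o d (2 * s) (≤-trans (proj₂ (deg≥ a)) (≤-trans
      (#-cover (_⟶? a) (λ w → (w ⟶? a) ×-dec (suc (2 * s) ≤? outside w)) (λ w → Hi? w ×-dec (w ⟶? a)) split)
      (+-monoˡ-≤ _ le)))
      where
      split : ∀ {w} → w ⟶ a → (w ⟶ a × suc (2 * s) ≤ outside w) ⊎ (Hi w × w ⟶ a)
      split {w} wa with suc (2 * s) ≤? outside w
      ... | yes lt = inj₁ (wa , lt)
      ... | no ¬lt = inj₂ ((∉A⁻ Aa wa , ≮⇒≥ ¬lt) , wa)
    Hi-outdegree : ∀ {w} → Hi w → # (λ a → E? a ×-dec (w ⟶? a)) ≤ 2 * s
    Hi-outdegree {w} hi = +-cancelˡ-≤ α _ _ (≤-trans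
      (≤-trans (#-disjoint A? (λ a → A? a ×-dec (a ⟶? w)) (λ a → E? a ×-dec (w ⟶? a)) proj₁ (proj₁ ∘ proj₁)
                 (λ { (_ , aw) (_ , wa) → asym aw wa })) #A≤d)
      (Hi-indegree hi))
      where
      α : ℕ
      α = # (λ a → A? a ×-dec (a ⟶? w))

  -- FW a lists the vertices outside A that a step back from a has to avoid.
  module Core (t f : ℕ) {A* T : Fin n → Set} (A*? : Decidable A*) (T? : Decidable T)
    (A*⊆A : ∀ {a} → A* a → A a) (A*∥E : ∀ {a} → A* a → ¬ E a) (T⊆A* : ∀ {a} → T a → A* a) (t<T : t < # T?)
    (X : List (Fin n)) (v∈X : v ∈ X) (FW : ∀ {a} → T a → List (Fin n))
    (FW≤ : ∀ {a} (Ta : T a) → length (FW Ta) ≤ f) (f≤2s : f ≤ 2 * s)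
    (X⊆FW : ∀ {a x} (Ta : T a) → x ∈ X → x ∈ FW Ta)
    (FW∩N⁻ : ∀ {a x} (Ta : T a) → x ∈ FW Ta → x ⟶ a → x ∈ X)
    (fails : ∀ {a w′ w} (Ta : T a) → w′ ⟶ a → w′ ∉ FW Ta → w ⟶ w′ → w ∉ FW Ta →
             # (λ x → A*? x ×-dec (x ⟶? w)) ≤ t)
    (share : 3 * (# (λ x → A? x ×-dec ¬? (A*? x)) + t) ≤ d)
    (room : suc (4 * # (λ x → A? x ×-dec ¬? (A*? x)) + 7 * t + 4 * f) ≤ 2 * d + 4)
    where

    r : ℕ
    r = # (λ x → A? x ×-dec ¬? (A*? x))

    -- Apart from vertices of A and FW, all in-neighbours of a vertex of L lie in L.
    L : Fin n → Set
    L w = ¬ A w × w ∉ X × # (λ x → A*? x ×-dec (x ⟶? w)) ≤ t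
    L? : Decidable L
    L? w = ¬? (A? w) ×-dec (¬? (w ∈? X) ×-dec (# (λ x → A*? x ×-dec (x ⟶? w)) ≤? t))

    d≤A*+r : d ≤ # A*? + r
    d≤A*+r = ≤-trans (proj₁ (deg≥ v)) (#-cover A? A*? (λ x → A? x ×-dec ¬? (A*? x)) split)
      where
      split : ∀ {x} → A x → A* x ⊎ (A x × ¬ A* x)
      split {x} Ax with A*? x
      ... | yes A*x = inj₁ A*x
      ... | no ¬A*x = inj₂ (Ax , ¬A*x)

    -- Since `T` has more than t vertices, some a in `T` sends no arc to e, so e → a by adjacency.
    -- Thus e can serve as w′ in a step back from a, and `fails` puts the remaining in-neighbours of
    -- e into `L`.
    L-indegree : ∀ {e} → L e → d ≤ r + t + f + # (λ w → L? w ×-dec (w ⟶? e))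
    L-indegree {e} (¬Ae , e∉X , few) with #-diff T? (λ x → A*? x ×-dec (x ⟶? e)) (≤-<-trans few t<T)
    ... | a , Ta , ¬ae with adjacent (A*⊆A (T⊆A* Ta)) ¬Ae
    ... | inj₁ ae = contradiction (T⊆A* Ta , ae) ¬ae
    ... | inj₂ ea = ≤-trans (proj₂ (deg≥ e)) (≤-trans (#-cover (_⟶? e) abf? Le? split₁)
      (+-monoˡ-≤ _ (≤-trans (#-cover abf? ab? (_∈? FW Ta) id)
        (+-mono-≤ (≤-trans (#-cover ab? r? A*e? id) (+-monoʳ-≤ r few))
                  (≤-trans (#-list≤ (FW Ta)) (FW≤ Ta))))))
      where
      r? : Decidable (λ x → A x × ¬ A* x)
      r? x = A? x ×-dec ¬? (A*? x)
      A*e? : Decidable (λ x → A* x × x ⟶ e)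
      A*e? x = A*? x ×-dec (x ⟶? e)
      ab? : Decidable (λ x → (A x × ¬ A* x) ⊎ (A* x × x ⟶ e))
      ab? x = r? x ⊎-dec A*e? x
      abf? : Decidable (λ x → ((A x × ¬ A* x) ⊎ (A* x × x ⟶ e)) ⊎ x ∈ FW Ta)
      abf? x = ab? x ⊎-dec (x ∈? FW Ta)
      Le? : Decidable (λ w → L w × w ⟶ e)
      Le? w = L? w ×-dec (w ⟶? e)
      split₁ : ∀ {w} → w ⟶ e → (((A w × ¬ A* w) ⊎ (A* w × w ⟶ e)) ⊎ w ∈ FW Ta) ⊎ (L w × w ⟶ e)
      split₁ {w} we with A? w | A*? w | w ∈? FW Ta
      ... | yes Aw | yes A*w | _       = inj₁ (inj₁ (inj₂ (A*w , we)))
      ... | yes Aw | no ¬A*w | _       = inj₁ (inj₁ (inj₁ (Aw , ¬A*w)))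
      ... | no ¬Aw | _       | yes w∈  = inj₁ (inj₂ w∈)
      ... | no ¬Aw | _       | no  w∉  = inj₂
        ((¬Aw , w∉ ∘ X⊆FW Ta , fails Ta ea (λ e∈ → e∉X (FW∩N⁻ Ta e∈ ea)) we w∉) , we)

    -- A vertex of `L` sends arcs to all but at most t vertices of `A*`. Each of these receives at
    -- most d - 1 of them, since its in-neighbour v is not in `L`.
    L-size : # L? * (# A*? ∸ t) ≤ # A*? * (d ∸ 1)
    L-size = double-count L? A*? _⟶?_ sends receives
      where
      sends : ∀ {e} → L e → # A*? ∸ t ≤ # (λ a → A*? a ×-dec (e ⟶? a))
      sends {e} (¬Ae , _ , few) = m≤n+o⇒m∸n≤o (# A*?) t (≤-trans
        (#-cover A*? (λ a → A*? a ×-dec (a ⟶? e)) (λ a → A*? a ×-dec (e ⟶? a)) split) (+-monoˡ-≤ _ few))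
        where
        split : ∀ {a} → A* a → (A* a × a ⟶ e) ⊎ (A* a × e ⟶ a)
        split A*a with adjacent (A*⊆A A*a) ¬Ae
        ... | inj₁ ae = inj₁ (A*a , ae)
        ... | inj₂ ea = inj₂ (A*a , ea)
      receives : ∀ {a} → A* a → # (λ e → L? e ×-dec (e ⟶? a)) ≤ d ∸ 1
      receives {a} A*a = m+n≤o⇒m≤o∸n _ (≤-trans (+-monoʳ-≤ _ (≤-reflexive (sym (#-singleton v))))
        (≤-trans (#-disjoint (_⟶? a) (λ e → L? e ×-dec (e ⟶? a)) (_≟ v) proj₂ (λ { refl → A*⊆A A*a })
                    (λ { ((_ , v∉X , _) , _) refl → v∉X v∈X }))
                 (deg⁻≤d (A*⊆A A*a))))

    absurd : ⊥
    absurd with any? L?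
    -- Some vertex of `L` has at most (|L| - 1)/2 in-neighbours in `L`, too few for its in-degree.
    ... | yes (_ , Le) = 1+n≰n (≤-trans room (min-indegree-arith (Degrees.min-outdegree (G ᵒᵖ) L? (#-inhabited L? Le))))
      where
      suc-pred-d : suc (d ∸ 1) ≡ d
      suc-pred-d = trans (+-comm 1 (d ∸ 1)) (m∸n+n≡m 1≤d)
      t≤A* : t ≤ # A*?
      t≤A* = linear 4 (λ a r t d → 1 ∙ 3 :* (r :+ t) ≼ d ∷ 1 ∙ d ≼ a :+ r ∷ [] ⊢ t ≼ a)
               (# A*? ∷ r ∷ t ∷ d ∷ []) share d≤A*+r
      min-indegree-arith : (∃[ e ] L e × 2 * # (λ y → L? y ×-dec (y ⟶? e)) + 1 ≤ # L?) → 2 * d + 4 ≤ 4 * r + 7 * t + 4 * f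
      min-indegree-arith (e , Le , min) = subst (λ k → 2 * k + 4 ≤ 4 * r + 7 * t + 4 * f) suc-pred-d
        (closed-set-arith {# L?} {# (λ y → L? y ×-dec (y ⟶? e))} {d ∸ 1} {# A*?} {r} {t} {f} {# A*? ∸ t}
          (≤-trans (≤-reflexive suc-pred-d) (L-indegree Le)) min L-size (sym (m∸n+n≡m t≤A*))
          (≤-trans (≤-reflexive suc-pred-d) d≤A*+r)
          (≤-trans share (≤-reflexive (sym suc-pred-d))))
    -- A vertex a of `T` is not in `E`, so more than 2s in-neighbours w′ of a have more than 2s
    -- in-neighbours outside A. The list `FW` has at most 2s entries, so a step back exists, and it
    -- ends in `L`.
    ... | no ¬L with #-witness T? (≤-trans (s≤s z≤n) t<T)
    ... | a , Ta with #-avoid (λ w → (w ⟶? a) ×-dec (suc (2 * s) ≤? outside w)) (FW Ta)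
                       (≤-<-trans (≤-trans (FW≤ Ta) f≤2s) (≰⇒> λ le → A*∥E (T⊆A* Ta) (A*⊆A (T⊆A* Ta) , le)))
    ... | w′ , (w′a , many) , w′∉ with #-avoid (λ x → ¬? (A? x) ×-dec (x ⟶? w′)) (FW Ta) (≤-<-trans (≤-trans (FW≤ Ta) f≤2s) many)
    ... | w , (¬Aw , ww′) , w∉ = ¬L (w , ¬Aw , w∉ ∘ X⊆FW Ta , fails Ta w′a w′∉ ww′ w∉)

  -- Backward chains of triples

  Free : List (Fin n) → Fin n → Set
  Free FA a = A a × ¬ E a × a ∉ FA
  Free? : ∀ FA → Decidable (Free FA)
  Free? FA a = A? a ×-dec (¬? (E? a) ×-dec ¬? (a ∈? FA))

  -- A path ending in a ∈ A can be prolonged backwards by j triples a′ w w′, where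
  -- FA and FW contain its vertices inside and outside A.
  Chain : ℕ → List (Fin n) → List (Fin n) → Fin n → Set
  Chain zero    FA FW a = ⊤
  Chain (suc j) FA FW a = ∃[ w′ ] (w′ ⟶ a × w′ ∉ FW) × ∃[ w ] (w ⟶ w′ × w ∉ FW) ×
                          ∃[ a′ ] (Free (a ∷ FA) a′ × a′ ⟶ w) × Chain j (a ∷ FA) (w ∷ w′ ∷ FW) a′

  Chain? : ∀ j FA FW → Decidable (Chain j FA FW)
  Chain? zero    FA FW a = yes tt
  Chain? (suc j) FA FW a =
    any? λ w′ → ((w′ ⟶? a) ×-dec ¬? (w′ ∈? FW)) ×-dec any? λ w → ((w ⟶? w′) ×-dec ¬? (w ∈? FW)) ×-dec
    any? λ a′ → (Free? (a ∷ FA) a′ ×-dec (a′ ⟶? w)) ×-dec Chain? j (a ∷ FA) (w ∷ w′ ∷ FW) a′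

  Bad : ℕ → List (Fin n) → List (Fin n) → Fin n → Set
  Bad j FA FW a = Free FA a × ¬ Chain j FA FW a
  Bad? : ∀ j FA FW → Decidable (Bad j FA FW)
  Bad? j FA FW a = Free? FA a ×-dec ¬? (Chain? j FA FW a)

  -- A free x ≠ a with x → w that had a chain of length j would complete a chain from a. So every
  -- such x is bad for the enlarged lists, and a itself adds 1.
  few-entries : ∀ {j FA FW a w′ w} → # (Bad? j (a ∷ FA) (w ∷ w′ ∷ FW)) ≤ j → ¬ Chain (suc j) FA FW a →
                w′ ⟶ a → w′ ∉ FW → w ⟶ w′ → w ∉ FW → # (λ x → Free? FA x ×-dec (x ⟶? w)) ≤ suc j
  few-entries {j} {FA} {FW} {a} {w′} {w} bad≤j ¬chain w′a w′∉ ww′ w∉ = ≤-trans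
    (#-cover (λ x → Free? FA x ×-dec (x ⟶? w)) (_≟ a) (Bad? j (a ∷ FA) (w ∷ w′ ∷ FW)) split)
    (+-mono-≤ (≤-reflexive (#-singleton a)) bad≤j)
    where
    split : ∀ {x} → Free FA x × x ⟶ w → x ≡ a ⊎ Bad j (a ∷ FA) (w ∷ w′ ∷ FW) x
    split {x} ((Ax , ¬Ex , x∉) , xw) with x ≟ a
    ... | yes x≡a = inj₁ x≡a
    ... | no  x≢a = inj₂ (free , λ chain → ¬chain (w′ , (w′a , w′∉) , w , (ww′ , w∉) , x , (free , xw) , chain))
      where
      free : Free (a ∷ FA) x
      free = Ax , ¬Ex , λ { (here eq) → x≢a eq ; (there m) → x∉ m }

  taken≤ : ∀ FA → # (λ x → A? x ×-dec ¬? (Free? FA x)) ≤ # E? + length FA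
  taken≤ FA = ≤-trans (#-cover (λ x → A? x ×-dec ¬? (Free? FA x)) E? (_∈? FA) split) (+-monoʳ-≤ (# E?) (#-list≤ FA))
    where
    split : ∀ {x} → A x × ¬ Free FA x → E x ⊎ x ∈ FA
    split {x} (Ax , ¬free) with E? x | x ∈? FA
    ... | yes Ex | _     = inj₁ Ex
    ... | no ¬Ex | yes m = inj₂ m
    ... | no ¬Ex | no x∉ = contradiction (Ax , ¬Ex , x∉) ¬free

  -- Induction on j through `Core`, with the bad vertices as `T`. A step back adds two entries to
  -- `FW` and one to `FA`, which preserves the two length bounds; the summand 2 leaves room for b
  -- and v.
  bad≤ : ∀ j FA FW → v ∈ FW → length FW + 2 * j ≤ 2 * s + 2 → length FA + j ≤ s → # (Bad? j FA FW) ≤ j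
  bad≤ zero    FA FW v∈ _  _  = ≤-reflexive (#-empty (Bad? zero FA FW) λ (_ , ¬chain) → ¬chain tt)
  bad≤ (suc j) FA FW v∈ h₁ h₂ = ≮⇒≥ λ bad> →
    Core.absurd (suc j) (length FW) (Free? FA) (Bad? (suc j) FA FW) proj₁ (λ free → proj₁ (proj₂ free)) proj₁ bad>
      FW v∈ (λ _ → FW) (λ _ → ≤-refl)
      (linear 3 (λ l j s → 1 ∙ l :+ 2 :* (con 1 :+ j) ≼ 2 :* s :+ con 2 ∷ [] ⊢ l ≼ 2 :* s) (length FW ∷ j ∷ s ∷ []) h₁)
      (λ _ m → m) (λ _ m _ → m)
      (λ {a} {w′} {w} (_ , ¬chain) w′a w′∉ ww′ w∉ → few-entries {FA = FA}
        (bad≤ j (a ∷ FA) (w ∷ w′ ∷ FW) (there (there v∈))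
          (linear 3 (λ l j s → 1 ∙ l :+ 2 :* (con 1 :+ j) ≼ 2 :* s :+ con 2 ∷ [] ⊢ con 2 :+ l :+ 2 :* j ≼ 2 :* s :+ con 2)
            (length FW ∷ j ∷ s ∷ []) h₁)
          (≤-trans (≤-reflexive (sym (+-suc (length FA) j))) h₂))
        ¬chain w′a w′∉ ww′ w∉)
      (share-arith 9E≤2d 13s≤d h₂ (taken≤ FA))
      (room-arith 9E≤2d 13s≤d h₂ (taken≤ FA) h₁ (s≤s z≤n))

  -- Vertices of `FA` lie in A and those of `FW` outside, so a new vertex can only repeat an entry
  -- of the list of its own side, which it avoids.
  unroll : ∀ j {FA FW a rest} → v ∈ FW → (∀ {x} → x ∈ FA → A x) → (∀ {x} → x ∈ FW → ¬ A x) →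
           (∀ {x} → x ∈ rest → x ∈ FA ⊎ x ∈ FW) → A a → Chain j FA FW a →
           Walk _⟶_ a (a ∷ rest) v → Unique (v ∷ a ∷ rest) →
           ∃[ a₁ ] ∃[ rest₁ ] A a₁ × Walk _⟶_ a₁ (a₁ ∷ rest₁) v × Unique (v ∷ a₁ ∷ rest₁) × length rest₁ ≡ 3 * j + length rest
  unroll zero v∈ FA⊆A FW∥A rest⊆ Aa _ walk u = _ , _ , Aa , walk , u , refl
  unroll (suc j) {FA} {FW} {a} {rest} v∈ FA⊆A FW∥A rest⊆ Aa
    (w′ , (w′a , w′∉) , w , (ww′ , w∉) , a′ , ((Aa′ , _ , a′∉) , a′w) , chain) walk ((v≢a ∷ v∉) ∷ (a∉ ∷ u)) =
    let a₁ , rest₁ , Aa₁ , walk₁ , u₁ , l₁ =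
          unroll j {rest = w ∷ w′ ∷ a ∷ rest} (there (there v∈))
            (λ { (here refl) → Aa ; (there m) → FA⊆A m })
            (λ { (here refl) → ¬Aw ; (there (here refl)) → ¬Aw′ ; (there (there m)) → FW∥A m })
            (λ { (here eq) → inj₂ (here eq) ; (there (here eq)) → inj₂ (there (here eq))
               ; (there (there (here eq))) → inj₁ (here eq)
               ; (there (there (there m))) → [ inj₁ ∘ there , inj₂ ∘ there ∘ there ]′ (rest⊆ m) })
            Aa′ chain (a′w ∷ ww′ ∷ w′a ∷ walk)
            (((λ { refl → ¬Av Aa′ }) ∷ (λ { refl → w∉ v∈ }) ∷ (λ { refl → w′∉ v∈ }) ∷ v≢a ∷ v∉)
             ∷ ((λ { refl → irrefl refl a′w }) ∷ (λ { refl → asym a′w ww′ }) ∷ (λ eq → a′∉ (here eq))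
               ∷ All.tabulate (λ { m refl → [ a′∉ ∘ there , (λ m′ → FW∥A m′ Aa′) ]′ (rest⊆ m) }))
             ∷ ((λ { refl → irrefl refl ww′ }) ∷ (λ { refl → ¬Aw Aa })
               ∷ All.tabulate (λ { m refl → [ ¬Aw ∘ FA⊆A , w∉ ]′ (rest⊆ m) }))
             ∷ ((λ { refl → irrefl refl w′a })
               ∷ All.tabulate (λ { m refl → [ ¬Aw′ ∘ FA⊆A , w′∉ ]′ (rest⊆ m) }))
             ∷ (a∉ ∷ u))
    in a₁ , rest₁ , Aa₁ , walk₁ , u₁ , trans l₁ (longer j (length rest))
    where
    ¬Aw : ¬ A w
    ¬Aw = ∉A⁺ Aa′ a′w
    ¬Aw′ : ¬ A w′
    ¬Aw′ = ∉A⁻ Aa w′a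
    longer : ∀ j l → 3 * j + (3 + l) ≡ 3 * suc j + l
    longer = solve-∀

  onCycle : OnCycle G v (3 * suc s)
  onCycle with any? (λ a → Free? [] a ×-dec any? (λ b → ((a ⟶? b) ×-dec (b ⟶? v)) ×-dec Chain? (suc k) [] (b ∷ v ∷ []) a))
  ... | yes (a , (Aa , _) , b , (ab , bv) , chain) =
    let a₁ , rest₁ , Aa₁ , walk₁ , u₁ , l₁ =
          unroll (suc k) {FA = []} {FW = b ∷ v ∷ []} {rest = b ∷ []} (there (here refl)) (λ ())
            (λ { (here refl) → ∉A⁺ Aa ab ; (there (here refl)) → ¬Av }) (λ { (here eq) → inj₂ (here eq) })
            Aa chain (ab ∷ bv ∷ [])
            (((λ { refl → ¬Av Aa }) ∷ (λ { refl → irrefl refl bv }) ∷ []) ∷ ((λ { refl → irrefl refl ab }) ∷ []) ∷ [] ∷ [])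
    in a₁ ∷ rest₁ , Aa₁ ∷ walk₁ , u₁ , trans (cong (2 +_) l₁) (trans (total (suc k)) (cong (λ s → 3 * suc s) (sym s≡1+k)))
    where
    total : ∀ s → 2 + (3 * s + 1) ≡ 3 * suc s
    total = solve-∀
  -- The closing vertex b depends on a, so here `FW` varies with a while `X` consists of v alone. As
  -- a → b, the vertex b is no in-neighbour of a.
  ... | no ¬chain = ⊥-elim (Core.absurd (suc k) 2 (Free? []) (Free? []) proj₁ (λ free → proj₁ (proj₂ free)) id
      (≤-<-trans 1+k≤s (most-free (≤-trans (proj₁ (deg≥ v)) (#-cover A? E? (Free? []) split)) 9E≤2d 13s≤d 1≤s))
      (v ∷ []) (here refl) (λ free → proj₁ (closing (proj₁ free)) ∷ v ∷ []) (λ _ → ≤-refl) (*-monoʳ-≤ 2 1≤s)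
      (λ { _ (here eq) → there (here eq) })
      (λ { free (here refl) ba → contradiction ba (asym (proj₁ (proj₂ (closing (proj₁ free))))) ; _ (there m) _ → m })
      (λ {a} {w′} {w} free w′a w′∉ ww′ w∉ → let b , ab , bv = closing (proj₁ free) in few-entries {FA = []}
        (bad≤ k (a ∷ []) (w ∷ w′ ∷ b ∷ v ∷ []) (there (there (there (here refl))))
          (linear 2 (λ k s → 2 ∙ con 1 :+ k ≼ s ∷ [] ⊢ con 4 :+ 2 :* k ≼ 2 :* s :+ con 2) (k ∷ s ∷ []) 1+k≤s) 1+k≤s)
        (λ chain → ¬chain (a , free , b , (ab , bv) , chain)) w′a w′∉ ww′ w∉)
      (share-arith {fa = 0} 9E≤2d 13s≤d 1+k≤s (taken≤ []))
      (room-arith {fa = 0} {f = 2} 9E≤2d 13s≤d 1+k≤s (taken≤ [])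
        (linear 2 (λ k s → 2 ∙ con 1 :+ k ≼ s ∷ [] ⊢ con 2 :+ 2 :* (con 1 :+ k) ≼ 2 :* s :+ con 2) (k ∷ s ∷ []) 1+k≤s) (s≤s z≤n)))
    where
    1+k≤s : suc k ≤ s
    1+k≤s = ≤-reflexive (sym s≡1+k)
    split : ∀ {x} → A x → E x ⊎ Free [] x
    split {x} Ax with E? x
    ... | yes Ex = inj₁ Ex
    ... | no ¬Ex = inj₂ (Ax , ¬Ex , λ ())

-- Hexagons

-- In an oriented graph, vertices one or two arcs apart are distinct, which leaves the three
-- antipodal pairs as hypotheses.
cycle₆ : ∀ {n} (G : OrientedGraph n) (let open OrientedGraph G) {v a b c e f} →
         v ⟶ a → a ⟶ b → b ⟶ c → c ⟶ e → e ⟶ f → f ⟶ v → v ≢ c → a ≢ e → b ≢ f → OnCycle G v 6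
cycle₆ G {a = a} {b} {c} {e} {f} va ab bc ce ef fv v≢c a≢e b≢f =
  a ∷ b ∷ c ∷ e ∷ f ∷ [] , va ∷ ab ∷ bc ∷ ce ∷ ef ∷ fv ∷ [] ,
  (irr va ∷ two va ab ∷ v≢c ∷ (λ eq → two ef fv (sym eq)) ∷ (λ eq → irr fv (sym eq)) ∷ [])
  ∷ (irr ab ∷ two ab bc ∷ a≢e ∷ (λ eq → two fv va (sym eq)) ∷ [])
  ∷ (irr bc ∷ two bc ce ∷ b≢f ∷ [])
  ∷ (irr ce ∷ two ce ef ∷ [])
  ∷ (irr ef ∷ [])
  ∷ [] ∷ [] , refl
  where
  open OrientedGraph G
  irr : ∀ {x y} → x ⟶ y → x ≢ y
  irr xy refl = irrefl refl xy
  two : ∀ {x y z} → x ⟶ y → y ⟶ z → x ≢ z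
  two xy yz refl = asym xy yz

-- Vertices at the end of three arcs from v, along v y z u or v z x u.
reached? : ∀ {n} (G : OrientedGraph n) (let open OrientedGraph G) (v z x : Fin n) →
           Decidable (λ u → u ≢ v × ((z ⟶ u) ⊎ (x ⟶ u)))
reached? G v z x u = ¬? (u ≟ v) ×-dec ((z ⟶? u) ⊎-dec (x ⟶? u))
  where open OrientedGraph G

module Spread {n : ℕ} (G : OrientedGraph n) (v : Fin n) {d : ℕ} (deg⁺≥ : ∀ x → d ≤ Degrees.deg⁺ G x) (7≤d : 7 ≤ d) where
  open OrientedGraph G
  open Degrees G

  -- If v is not on a 6-cycle v y z x₁ x₂ x₃, then x can be chosen outside N⁻(v), or else
  -- N⁺(z) contains no path of three vertices and x is nearly a sink in it.
  spread : ∀ {y z c₁ c₂} → v ⟶ y → v ⟶ z → y ⟶ z → c₁ ⟶ v → c₂ ⟶ v →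
           OnCycle G v 6 ⊎ ∃[ x ] z ⟶ x × x ≢ c₁ × x ≢ c₂ × 3 * d + 1 ≤ 2 * # (reached? G v z x)
  spread {y} {z} {c₁} {c₂} vy vz yz c₁v c₂v
    with any? (λ x₁ → any? λ x₂ → any? λ x₃ → ((z ⟶? x₁) ×-dec ((z ⟶? x₂) ×-dec (z ⟶? x₃))) ×-dec
                                              ((x₁ ⟶? x₂) ×-dec ((x₂ ⟶? x₃) ×-dec (x₃ ⟶? v))))
  ... | yes (x₁ , x₂ , x₃ , (zx₁ , zx₂ , zx₃) , x₁x₂ , x₂x₃ , x₃v) = inj₁
    (cycle₆ G vy yz zx₁ x₁x₂ x₂x₃ x₃v (λ { refl → asym vz zx₁ }) (λ { refl → asym yz zx₂ }) (λ { refl → irrefl refl zx₃ }))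
  ... | no ¬path = inj₂ (choose (any? Inner?))
    where
    Leads Inner : Fin n → Set
    Leads x = ∃[ b ] (z ⟶ b × b ⟶ v) × x ⟶ b
    Inner x = z ⟶ x × ¬ x ⟶ v × ¬ Leads x
    Leads? : Decidable Leads
    Leads? x = any? λ b → ((z ⟶? b) ×-dec (b ⟶? v)) ×-dec (x ⟶? b)
    Inner? : Decidable Inner
    Inner? x = (z ⟶? x) ×-dec (¬? (x ⟶? v) ×-dec ¬? (Leads? x))

    Goal : Set
    Goal = ∃[ x ] z ⟶ x × x ≢ c₁ × x ≢ c₂ × 3 * d + 1 ≤ 2 * # (reached? G v z x)

    cs : List (Fin n)
    cs = c₁ ∷ c₂ ∷ []

    reached-z : ∀ {x u} → z ⟶ u → u ≢ v × ((z ⟶ u) ⊎ (x ⟶ u))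
    reached-z zu = (λ { refl → asym vz zu }) , inj₁ zu

    fromSink : ∀ {x} → z ⟶ x → x ∉ cs → (∀ {u} → x ⟶ u → z ⟶ u → u ∈ cs) → Goal
    fromSink {x} zx x∉ sink = x , zx , (λ eq → x∉ (here eq)) , (λ eq → x∉ (there (here eq))) ,
      sink-arith 7≤d (deg⁺≥ z)
        (≤-trans (deg⁺≥ x) (≤-trans (#-cover (x ⟶?_) (_∈? (v ∷ cs)) Out? split) (+-monoˡ-≤ _ (#-list≤ (v ∷ cs)))))
        (#-disjoint (reached? G v z x) (z ⟶?_) Out? reached-z (λ (xu , u∉) → (λ eq → u∉ (here eq)) , inj₂ xu)
                    (λ zu (xu , u∉) → u∉ (there (sink xu zu))))
      where
      Out? : Decidable (λ u → x ⟶ u × u ∉ (v ∷ cs))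
      Out? u = (x ⟶? u) ×-dec ¬? (u ∈? (v ∷ cs))
      split : ∀ {u} → x ⟶ u → u ∈ (v ∷ cs) ⊎ (x ⟶ u × u ∉ (v ∷ cs))
      split {u} xu with u ∈? (v ∷ cs)
      ... | yes m = inj₁ m
      ... | no u∉ = inj₂ (xu , u∉)

    choose : Dec (∃[ x ] Inner x) → Goal
    -- An out-neighbour u of x in N⁺(z) is again `Inner`: u → v would make x lead to v, and u
    -- leading to v would give a path x, u, b. Hence the other out-neighbours of x lie outside
    -- N⁺(z).
    choose (yes (_ , inner₀)) with min-outdegree Inner? (#-inhabited Inner? inner₀)
    ... | x , (zx , ¬xv , ¬leads) , min = x , zx , (λ { refl → ¬xv c₁v }) , (λ { refl → ¬xv c₂v }) ,
      spread-arith min (#-mono Inner? (z ⟶?_) proj₁) (deg⁺≥ z)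
        (≤-trans (deg⁺≥ x) (#-cover (x ⟶?_) (λ u → Inner? u ×-dec (x ⟶? u)) Out? split))
        (#-disjoint (reached? G v z x) (z ⟶?_) Out? reached-z (λ (xu , _) → (λ { refl → ¬xv xu }) , inj₂ xu)
          (λ {u} zu (xu , ¬inner) → ¬inner (zu , (λ uv → ¬leads (u , (zu , uv) , xu)) ,
            λ (b , (zb , bv) , ub) → ¬path (x , u , b , (zx , zu , zb) , xu , ub , bv))))
      where
      Out? : Decidable (λ u → x ⟶ u × ¬ Inner u)
      Out? u = (x ⟶? u) ×-dec ¬? (Inner? u)
      split : ∀ {u} → x ⟶ u → (Inner u × x ⟶ u) ⊎ (x ⟶ u × ¬ Inner u)
      split {u} xu with Inner? u
      ... | yes i = inj₁ (i , xu)
      ... | no ¬i = inj₂ (xu , ¬i)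
    -- Without `Inner` vertices, x has no out-neighbour in N⁺(z) apart from c₁ and c₂, or a
    -- successor x′ of x is a sink of N⁺(z): any u after x′ would be `Inner`, as `¬path` shows.
    choose (no ¬inner) with #-avoid (z ⟶?_) cs (≤-trans (≤-trans (s≤s (s≤s (s≤s z≤n))) 7≤d) (deg⁺≥ z))
    ... | x , zx , x∉ with any? (λ x′ → (z ⟶? x′) ×-dec (¬? (x′ ∈? cs) ×-dec (x ⟶? x′)))
    ... | no ¬x′ = fromSink zx x∉ λ {u} xu zu → decidable-stable (u ∈? cs) λ u∉ → ¬x′ (u , zu , u∉ , xu)
    ... | yes (x′ , zx′ , x′∉ , xx′) = fromSink zx′ x′∉ λ {u} x′u zu → ⊥-elim (¬inner (u , zu ,
            (λ uv → ¬path (x , x′ , u , (zx , zx′ , zu) , xx′ , x′u , uv)) ,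
            λ (b , (zb , bv) , ub) → ¬path (x′ , u , b , (zx′ , zu , zb) , x′u , ub , bv)))

-- Unless a 6-cycle has already been found, more than half of the vertices end three arcs from v and
-- more than half begin three arcs to v, so the two sets meet.
hexagon : ∀ {n} (G : OrientedGraph n) (let open OrientedGraph G) {v : Fin n} {d : ℕ} → n ≤ 3 * d → 7 ≤ d →
          (∀ x → d ≤ Degrees.deg⁺ G x × d ≤ Degrees.deg⁻ G x) →
          ∀ {y z y′ z′} → v ⟶ y → v ⟶ z → y ⟶ z → y′ ⟶ v → z′ ⟶ v → z′ ⟶ y′ → OnCycle G v 6
hexagon G {v} {d} n≤3d 7≤d deg≥ {y} {z} {y′} {z′} vy vz yz y′v z′v z′y′ =
  combine (Spread.spread G v (proj₁ ∘ deg≥) 7≤d vy vz yz y′v z′v)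
          (Spread.spread (G ᵒᵖ) v (proj₂ ∘ deg≥) 7≤d y′v z′v z′y′ vy vz)
  where
  open OrientedGraph G
  apart : ∀ {a b} → v ⟶ a → b ⟶ v → a ≢ b
  apart va bv refl = asym va bv
  close : ∀ {x x′ u} → z ⟶ x → x ≢ y′ → x ≢ z′ → x′ ⟶ z′ → x′ ≢ y → x′ ≢ z → v ≢ u →
          (z ⟶ u) ⊎ (x ⟶ u) → (u ⟶ z′) ⊎ (u ⟶ x′) → OnCycle G v 6
  close zx x≢y′ x≢z′ x′z′ x′≢y x′≢z v≢u (inj₁ zu) (inj₁ uz′) = cycle₆ G vy yz zu uz′ z′y′ y′v v≢u (apart vy z′v) (apart vz y′v)
  close zx x≢y′ x≢z′ x′z′ x′≢y x′≢z v≢u (inj₁ zu) (inj₂ ux′) = cycle₆ G vy yz zu ux′ x′z′ z′v v≢u (x′≢y ∘ sym) (apart vz z′v)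
  close zx x≢y′ x≢z′ x′z′ x′≢y x′≢z v≢u (inj₂ xu) (inj₁ uz′) = cycle₆ G vz zx xu uz′ z′y′ y′v v≢u (apart vz z′v) x≢y′
  close zx x≢y′ x≢z′ x′z′ x′≢y x′≢z v≢u (inj₂ xu) (inj₂ ux′) = cycle₆ G vz zx xu ux′ x′z′ z′v v≢u (x′≢z ∘ sym) x≢z′
  combine : OnCycle G v 6 ⊎ (∃[ x ] z ⟶ x × x ≢ y′ × x ≢ z′ × 3 * d + 1 ≤ 2 * # (reached? G v z x)) →
            OnCycle (G ᵒᵖ) v 6 ⊎ (∃[ x ] x ⟶ z′ × x ≢ y × x ≢ z × 3 * d + 1 ≤ 2 * # (reached? (G ᵒᵖ) v z′ x)) → OnCycle G v 6
  combine (inj₁ c) _        = c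
  combine (inj₂ _) (inj₁ c) = onCycle-op {G = G} c
  combine (inj₂ (x , zx , x≢y′ , x≢z′ , large)) (inj₂ (x′ , x′z′ , x′≢y , x′≢z , large′)) =
    let u , (u≢v , out) , (_ , in′) = #-meet {R = λ _ → ⊤} (λ _ → yes tt) (reached? G v z x) (reached? (G ᵒᵖ) v z′ x′) (λ _ → tt) (λ _ → tt)
              (≤-<-trans (#-full {P = λ _ → ⊤} (λ _ → yes tt))
                (overlap-arith {# (reached? G v z x)} {# (reached? (G ᵒᵖ) v z′ x′)} {d} large large′ n≤3d))
    in close zx x≢y′ x≢z′ x′z′ x′≢y x′≢z (λ eq → u≢v (sym eq)) out in′

-- Connecting paths that avoid a given set

module Avoiding {n : ℕ} (G : OrientedGraph n) (L : List (Fin n)) where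
  open OrientedGraph G
  open Degrees G

  -- The arc from s to t is left out because the connecting path needs at least two arcs.
  H : Fin n → Fin n → Fin n → Fin n → Set
  H s t x y = x ⟶ y × x ∉ L × y ∉ L × ¬ (x ≡ s × y ≡ t)

  Reach : Fin n → Fin n → ℕ → Fin n → Set
  Reach s t k u = ∃[ xs ] Walk (H s t) s (s ∷ xs) u × suc (length xs) ≤ k

  -- `Mem` need not contain everything within k arcs: each further radius is gained from the
  -- out-neighbours of a single vertex.
  record Ball (s t : Fin n) (k : ℕ) : Set₁ where
    field
      Mem    : Fin n → Set
      mem?   : Decidable Mem
      avoid  : ∀ {u} → Mem u → u ∉ L
      reach  : ∀ {u} → Mem u → Reach s t k u

    size : ℕ
    size = # mem?

  open Ball

  outside≤ : ∀ {d} x → d ≤ deg⁺ x → {P : Fin n → Set} (P? : Decidable P) →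
             d ≤ length L + # (λ u → P? u ×-dec (x ⟶? u)) + # (λ u → (x ⟶? u) ×-dec (¬? (u ∈? L) ×-dec ¬? (P? u)))
  outside≤ x d≤ {P} P? = ≤-trans d≤ (≤-trans (#-cover (x ⟶?_) LP? rest? split)
    (+-monoˡ-≤ _ (≤-trans (#-cover LP? (_∈? L) (λ u → P? u ×-dec (x ⟶? u)) id) (+-monoˡ-≤ _ (#-list≤ L)))))
    where
    LP? : Decidable (λ u → u ∈ L ⊎ (P u × x ⟶ u))
    LP? u = (u ∈? L) ⊎-dec (P? u ×-dec (x ⟶? u))
    rest? : Decidable (λ u → x ⟶ u × u ∉ L × ¬ P u)
    rest? u = (x ⟶? u) ×-dec (¬? (u ∈? L) ×-dec ¬? (P? u))
    split : ∀ {u} → x ⟶ u → (u ∈ L ⊎ (P u × x ⟶ u)) ⊎ (x ⟶ u × u ∉ L × ¬ P u)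
    split {u} xu with u ∈? L | P? u
    ... | yes m | _      = inj₁ (inj₁ m)
    ... | no _  | yes pu = inj₁ (inj₂ (pu , xu))
    ... | no u∉ | no ¬pu = inj₂ (xu , u∉ , ¬pu)

  -- As x differs from s, none of the added arcs is the omitted one.
  extend : ∀ {s t k} (B : Ball s t k) {x} → Mem B x → x ≢ s → Ball s t (suc k)
  extend {s} {t} {k} B {x} x∈ x≢s = record
    { Mem   = λ u → Mem B u ⊎ (x ⟶ u × u ∉ L)
    ; mem?  = λ u → mem? B u ⊎-dec ((x ⟶? u) ×-dec ¬? (u ∈? L))
    ; avoid = [ avoid B , proj₂ ]′
    ; reach = [ (λ m → let xs , w , l = reach B m in xs , w , m≤n⇒m≤1+n l) , further ]′
    }
    where
    further : ∀ {u} → x ⟶ u × u ∉ L → Reach s t (suc k) u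
    further (xu , u∉) = let xs , w , l = reach B x∈ in
      xs ++ x ∷ [] , w ++ʷ ((xu , avoid B x∈ , u∉ , λ (eq , _) → x≢s eq) ∷ []) ,
      s≤s (≤-trans (≤-reflexive (trans (length-++ xs) (+-comm (length xs) 1))) l)

  extend-size : ∀ {d s t k} (B : Ball s t k) {x} (x∈ : Mem B x) (x≢s : x ≢ s) → d ≤ deg⁺ x →
                2 * # (λ u → mem? B u ×-dec (x ⟶? u)) + 1 ≤ size B →
                size B + 2 * d + 1 ≤ 2 * size (extend B x∈ x≢s) + 2 * length L
  extend-size {d} B {x} x∈ x≢s d≤ min = grow-arith {m = size B} {q = size (extend B x∈ x≢s)} {d} {length L} min (outside≤ x d≤ (mem? B))
    (#-disjoint (mem? (extend B x∈ x≢s)) (mem? B) (λ u → (x ⟶? u) ×-dec (¬? (u ∈? L) ×-dec ¬? (mem? B u)))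
      inj₁ (λ (xu , u∉ , _) → inj₂ (xu , u∉)) (λ m (_ , _ , ¬m) → ¬m m))

  module _ {s t : Fin n} (s∉L : s ∉ L) {l : Fin n} (l∈L : l ∈ L) (ls : l ⟶ s) {d : ℕ} (deg⁺≥ : ∀ x → d ≤ deg⁺ x) where

    ball₁ : Ball s t 1
    ball₁ = record
      { Mem   = λ u → s ⟶ u × u ∉ L × u ≢ t
      ; mem?  = λ u → (s ⟶? u) ×-dec (¬? (u ∈? L) ×-dec ¬? (u ≟ t))
      ; avoid = λ (_ , u∉ , _) → u∉
      ; reach = λ (su , u∉ , u≢t) → [] , (su , s∉L , u∉ , λ (_ , eq) → u≢t eq) ∷ [] , s≤s z≤n
      }

    ≢s : ∀ {x} → Mem ball₁ x → x ≢ s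
    ≢s (sx , _) refl = irrefl refl sx

    -- l ∈ L is not an out-neighbour of s, which makes up for the exclusion of t.
    ball₁-size : d ≤ size ball₁ + length L
    ball₁-size = ≤-trans (deg⁺≥ s) (≤-trans (#-cover (s ⟶?_) (mem? ball₁) Lt? split) (+-monoʳ-≤ _ (≤-trans
      (#-cover Lt? (λ u → (u ∈? L) ×-dec (s ⟶? u)) (_≟ t) id)
      (≤-trans (≤-reflexive (cong (_ +_) (trans (#-singleton t) (sym (#-singleton l)))))
        (≤-trans (#-disjoint (_∈? L) (λ u → (u ∈? L) ×-dec (s ⟶? u)) (_≟ l) proj₁ (λ { refl → l∈L })
                   (λ { (_ , su) refl → asym su ls }))
                 (#-list≤ L))))))
      where
      Lt? : Decidable (λ u → (u ∈ L × s ⟶ u) ⊎ u ≡ t)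
      Lt? u = ((u ∈? L) ×-dec (s ⟶? u)) ⊎-dec (u ≟ t)
      split : ∀ {u} → s ⟶ u → (s ⟶ u × u ∉ L × u ≢ t) ⊎ ((u ∈ L × s ⟶ u) ⊎ u ≡ t)
      split {u} su with u ∈? L | u ≟ t
      ... | yes m | _      = inj₂ (inj₁ (m , su))
      ... | no _  | yes eq = inj₂ (inj₂ eq)
      ... | no u∉ | no u≢t = inj₁ (su , u∉ , u≢t)

    module _ (L<d : length L < d) where

      nonempty₁ : 1 ≤ size ball₁
      nonempty₁ = +-cancelʳ-≤ (length L) 1 (size ball₁) (≤-trans L<d ball₁-size)

      radius₂ : ∃[ x ] Σ[ x∈ ∈ Mem ball₁ x ] Σ[ x≢s ∈ x ≢ s ] 3 * d + 1 ≤ 2 * size (extend ball₁ x∈ x≢s) + 3 * length L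
      radius₂ = let x , x∈ , min = min-outdegree (mem? ball₁) nonempty₁
                    x≢s = ≢s x∈
                in x , x∈ , x≢s , radius₂-arith {size ball₁} {size (extend ball₁ x∈ x≢s)} {d} {length L} ball₁-size (extend-size ball₁ x∈ x≢s (deg⁺≥ x) min)

      ball₂ : Ball s t 2
      ball₂ = let x , x∈ , x≢s , _ = radius₂ in extend ball₁ x∈ x≢s

      ball₂-size : 3 * d + 1 ≤ 2 * size ball₂ + 3 * length L
      ball₂-size = let _ , _ , _ , large = radius₂ in large

      -- Ensures that the vertex from which the third step is taken differs from s.
      s∉ball₂ : ¬ Mem ball₂ s
      s∉ball₂ (inj₁ (ss , _)) = irrefl refl ss
      s∉ball₂ (inj₂ (xs , _)) = let _ , (sx , _) , _ = radius₂ in asym sx xs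

      radius₃ : ∃[ x ] Σ[ x∈ ∈ Mem ball₂ x ] Σ[ x≢s ∈ x ≢ s ] 7 * d + 3 ≤ 4 * size (extend ball₂ x∈ x≢s) + 7 * length L
      radius₃ = let x , x∈ , min = min-outdegree (mem? ball₂) (≤-trans nonempty₁ (#-mono (mem? ball₁) (mem? ball₂) inj₁))
                    x≢s = λ eq → s∉ball₂ (subst (Mem ball₂) eq x∈)
                in x , x∈ , x≢s , radius₃-arith {size ball₂} {size (extend ball₂ x∈ x≢s)} {d} {length L} ball₂-size (extend-size ball₂ x∈ x≢s (deg⁺≥ x) min)

      ball₃ : Ball s t 3
      ball₃ = let x , x∈ , x≢s , _ = radius₃ in extend ball₂ x∈ x≢s

      ball₃-size : 7 * d + 3 ≤ 4 * size ball₃ + 7 * length L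
      ball₃-size = let _ , _ , _ , large = radius₃ in large

      module _ (no-path : ∀ {x x′ x″} → Mem ball₁ x → Mem ball₁ x′ → Mem ball₁ x″ → x ⟶ x′ → ¬ x′ ⟶ x″) where

        sink : ∃[ x ] Mem ball₁ x × (∀ {u} → Mem ball₁ u → ¬ x ⟶ u)
        sink with #-witness (mem? ball₁) nonempty₁
        ... | x , x∈ with any? (λ x′ → mem? ball₁ x′ ×-dec (x ⟶? x′))
        ... | yes (x′ , x′∈ , xx′) = x′ , x′∈ , λ u∈ → no-path x∈ x′∈ u∈ xx′
        ... | no ¬x′ = x , x∈ , λ {u} u∈ xu → ¬x′ (u , u∈ , xu)

        -- All out-neighbours of a sink outside `L` are new, so the second step gains about d
        -- vertices instead of about d/2.
        wide : Σ[ B ∈ Ball s t 2 ] 2 * d ≤ size B + 2 * length L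
        wide = let x , x∈ , sinks = sink
                   x≢s = ≢s x∈
                   B = extend ball₁ x∈ x≢s
               in B , wide-arith {size ball₁} {size B} {d = d} {length L} ball₁-size
                    (≤-trans (outside≤ x (deg⁺≥ x) (mem? ball₁)) (+-monoˡ-≤ _ (≤-reflexive
                      (trans (cong (length L +_) (#-empty (λ u → mem? ball₁ u ×-dec (x ⟶? u)) (λ (m , xu) → sinks m xu)))
                             (+-identityʳ (length L))))))
                    (#-disjoint (mem? B) (mem? ball₁) (λ u → (x ⟶? u) ×-dec (¬? (u ∈? L) ×-dec ¬? (mem? ball₁ u)))
                      inj₁ (λ (xu , u∉ , _) → inj₂ (xu , u∉)) (λ m (_ , _ , ¬m) → ¬m m))

open Avoiding using (Ball; H)

Connection : ∀ {n} (G : OrientedGraph n) (L : List (Fin n)) (s t : Fin n) → ℕ → Set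
Connection G L s t k = ∃[ xs ] Walk (OrientedGraph._⟶_ G) s xs t × Unique xs × t ∉ xs × All (_∉ L) xs × 2 ≤ length xs × length xs ≤ k

-- Both balls lie outside `L`, so by their sizes they meet. The walk through a common vertex is made
-- simple, and it keeps at least two arcs because s ≠ t and the arc from s to t is left out.
connect : ∀ {n} (G : OrientedGraph n) (L : List (Fin n)) {s t k k′} → Unique L → s ≢ t →
          (B : Ball G L s t k) (B′ : Ball (G ᵒᵖ) L t s k′) → n < Ball.size B + Ball.size B′ + length L →
          Connection G L s t (k + k′)
connect {n} G L {s} {t} {k} {k′} uL s≢t B B′ large =
  let u , m , m′          = #-meet (λ u → ¬? (u ∈? L)) (Ball.mem? B) (Ball.mem? B′) (Ball.avoid B) (Ball.avoid B′) crowded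
      xs , w , l          = Ball.reach B m
      ys , w′ , l′        = Ball.reach B′ m′
      w″                  = mapʷ {R = λ x y → H (G ᵒᵖ) L t s y x} (λ (yx , x∉ , y∉ , ¬eq) → yx , y∉ , x∉ , λ (e , e′) → ¬eq (e′ , e)) (reverseʷ w′)
      zs , w‴ , uz , t∉ , l″ = erase (w ++ʷ w″) (≤-trans (≤-reflexive (length-++ (s ∷ xs)))
                                  (+-mono-≤ l (≤-trans (s≤s (≤-reflexive (length-reverse ys))) l′)))
  in zs , mapʷ proj₁ w‴ , uz , t∉ , sources (λ (_ , x∉ , _) → x∉) w‴ , two w‴ , l″
  where
  crowded : # (λ u → ¬? (u ∈? L)) < Ball.size B + Ball.size B′
  crowded = +-cancelʳ-< (length L) _ _ (≤-<-trans (≤-trans (+-monoʳ-≤ _ (#-list≥ uL))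
    (≤-trans (#-disjoint {R = λ _ → ⊤} (λ _ → yes tt) (λ u → ¬? (u ∈? L)) (_∈? L) (λ _ → tt) (λ _ → tt) (λ u∉ u∈ → u∉ u∈))
             (#-full {P = λ _ → ⊤} (λ _ → yes tt)))) large)
  two : ∀ {zs} → Walk (H G L s t) s zs t → 2 ≤ length zs
  two []                         = ⊥-elim (s≢t refl)
  two ((_ , _ , _ , ¬st) ∷ [])   = ⊥-elim (¬st (refl , refl))
  two (_ ∷ _ ∷ _)                = s≤s (s≤s z≤n)

-- Cycles of length at least 9

module Segments {n : ℕ} (G : OrientedGraph n) (v : Fin n) {d : ℕ} (n≤3d : n ≤ 3 * d)
  (deg≥ : ∀ x → d ≤ Degrees.deg⁺ G x × d ≤ Degrees.deg⁻ G x) where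
  open OrientedGraph G

  assemble : ∀ {s t as xs ps a c b} →
             Walk _⟶_ v (v ∷ as) s → Unique (v ∷ as) → length as ≡ a →
             Walk _⟶_ s xs t → Unique xs → length xs ≡ c →
             Walk _⟶_ t (t ∷ ps) v → Unique (t ∷ ps) → length ps ≡ b →
             (∀ {x} → x ∈ v ∷ as → x ∉ xs) → (∀ {x} → x ∈ v ∷ as → x ∉ t ∷ ps) → (∀ {x} → x ∈ xs → x ∉ t ∷ ps) →
             OnCycle G v (suc a + (c + suc b))
  assemble {s} {t} {as} {xs} {ps} w₁ u₁ refl w₂ u₂ refl w₃ u₃ refl d₁₂ d₁₃ d₂₃ =
    as ++ xs ++ t ∷ ps , w₁ ++ʷ (w₂ ++ʷ w₃) ,
    unique-++ u₁ (unique-++ u₂ u₃ (λ (m , m′) → d₂₃ m m′))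
      (λ (m , m′) → [ d₁₂ m , d₁₃ m ]′ (∈-++⁻ xs m′)) ,
    cong suc (trans (length-++ as) (cong (length as +_) (length-++ xs)))

  -- Two walks from t to v, of lengths p + 1 and p + 2, obtained by prolonging
  -- z′ → v and z′ → y′ → v backwards.
  record Tail (M : List (Fin n)) (z′ y′ : Fin n) (p : ℕ) : Set where
    field
      t            : Fin n
      long short   : List (Fin n)
      long-walk    : Walk _⟶_ t (t ∷ long) v
      short-walk   : Walk _⟶_ t (t ∷ short) v
      long-length  : length long ≡ suc p
      short-length : length short ≡ p
      long-unique  : Unique (t ∷ long)
      short-unique : Unique (t ∷ short)
      short⊆long   : ∀ {x} → x ∈ short → x ∈ long
      y′∈long      : y′ ∈ long
      z′∈          : z′ ∈ t ∷ long
      fresh        : ∀ {x} → x ∈ t ∷ long → x ∉ M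

  tail : ∀ {M z′ y′} p → z′ ⟶ v → z′ ⟶ y′ → y′ ⟶ v → z′ ∉ M → y′ ∉ M → length M + (2 + p) ≤ d → Tail M z′ y′ p
  tail {M} {z′} {y′} zero z′v z′y′ y′v z′∉M y′∉M _ = record
    { t            = z′
    ; long         = y′ ∷ []
    ; short        = []
    ; long-walk    = z′y′ ∷ y′v ∷ []
    ; short-walk   = z′v ∷ []
    ; long-length  = refl
    ; short-length = refl
    ; long-unique  = ((λ { refl → irrefl refl z′y′ }) ∷ []) ∷ [] ∷ []
    ; short-unique = [] ∷ []
    ; short⊆long   = λ ()
    ; y′∈long      = here refl
    ; z′∈          = here refl
    ; fresh        = λ { (here refl) → z′∉M ; (there (here refl)) → y′∉M }
    }
  tail {M} {z′} {y′} (suc p) z′v z′y′ y′v z′∉M y′∉M room = record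
    { t            = t₁
    ; long         = t ∷ long
    ; short        = t ∷ short
    ; long-walk    = t₁t ∷ long-walk
    ; short-walk   = t₁t ∷ short-walk
    ; long-length  = cong suc long-length
    ; short-length = cong suc short-length
    ; long-unique  = All.tabulate (λ { m refl → t₁∉ (∈-++⁺ʳ M m) }) ∷ long-unique
    ; short-unique = All.tabulate (λ { m refl → t₁∉ (∈-++⁺ʳ M (widen m)) }) ∷ short-unique
    ; short⊆long   = widen
    ; y′∈long      = there y′∈long
    ; z′∈          = there z′∈
    ; fresh        = λ { (here refl) → t₁∉ ∘ ∈-++⁺ˡ ; (there m) → fresh m }
    }
    where
    rest : Tail M z′ y′ p
    rest = tail p z′v z′y′ y′v z′∉M y′∉M (≤-trans (+-monoʳ-≤ (length M) (n≤1+n (2 + p))) room)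
    open Tail rest
    widen : ∀ {x} → x ∈ t ∷ short → x ∈ t ∷ long
    widen (here eq) = here eq
    widen (there m) = there (short⊆long m)
    step : ∃[ t₁ ] t₁ ⟶ t × t₁ ∉ M ++ t ∷ long
    step = #-avoid (_⟶? t) (M ++ t ∷ long) (≤-trans (≤-reflexive (cong suc (trans (length-++ M) (cong (λ k → length M + suc k) long-length))))
             (≤-trans (≤-reflexive (sym (+-suc (length M) (2 + p)))) (≤-trans room (proj₂ (deg≥ t)))))
    t₁ : Fin n
    t₁ = proj₁ step
    t₁t : t₁ ⟶ t
    t₁t = proj₁ (proj₂ step)
    t₁∉ : t₁ ∉ M ++ t ∷ long
    t₁∉ = proj₂ (proj₂ step)

  -- The connection avoids all of `pre`, so the head, whose vertices come from `pre`, can be chosen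
  -- after the length of the connection is known.
  Head : List (Fin n) → Fin n → ℕ → Set
  Head pre s a = ∃[ as ] Walk _⟶_ v (v ∷ as) s × Unique (v ∷ as) × (∀ {x} → x ∈ v ∷ as → x ∈ pre) × length as ≡ a

  module Closing {pre : List (Fin n)} {s z′ y′ : Fin n} {p : ℕ} (pre-unique : Unique pre) (s∉pre : s ∉ pre)
    (T : Tail (s ∷ pre) z′ y′ p) where
    open Tail T

    L : List (Fin n)
    L = pre ++ long

    L-unique : Unique L
    L-unique with long-unique
    ... | _ ∷ u = unique-++ pre-unique u (λ (m , m′) → fresh (there m′) (there m))

    s∉L : s ∉ L
    s∉L m = [ s∉pre , (λ m′ → fresh (there m′) (here refl)) ]′ (∈-++⁻ pre m)

    t∉L : t ∉ L
    t∉L m with long-unique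
    ... | t∉ ∷ _ = [ (λ m′ → fresh (here refl) (there m′)) , (λ m′ → All.lookup t∉ m′ refl) ]′ (∈-++⁻ pre m)

    s≢t : s ≢ t
    s≢t eq = fresh (here refl) (here (sym eq))

    -- Provides the vertex of `L` that offsets the exclusion of s from the ball around t in the
    -- reversed graph.
    successor : ∃[ l ] l ∈ L × t ⟶ l
    successor = after long-walk long-length
      where
      after : ∀ {ps} → Walk _⟶_ t (t ∷ ps) v → length ps ≡ suc p → ∃[ l ] l ∈ pre ++ ps × t ⟶ l
      after (tl ∷ _ ∷ _) _ = _ , ∈-++⁺ʳ pre (here refl) , tl

    close-long : ∀ {a c k} → Head pre s a → (C : Connection G L s t k) → length (proj₁ C) ≡ c → OnCycle G v (suc a + (c + suc (suc p)))
    close-long (as , w , u , as⊆ , la) (xs , w′ , u′ , t∉xs , avoids , _) lc =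
      assemble w u la w′ u′ lc long-walk long-unique long-length
        (λ m m′ → All.lookup avoids m′ (∈-++⁺ˡ (as⊆ m)))
        (λ m m′ → fresh m′ (there (as⊆ m)))
        (λ { m (here refl) → t∉xs m ; m (there m′) → All.lookup avoids m (∈-++⁺ʳ pre m′) })

    close-short : ∀ {a c k} → Head pre s a → (C : Connection G L s t k) → length (proj₁ C) ≡ c → OnCycle G v (suc a + (c + suc p))
    close-short (as , w , u , as⊆ , la) (xs , w′ , u′ , t∉xs , avoids , _) lc =
      assemble w u la w′ u′ lc short-walk short-unique short-length
        (λ m m′ → All.lookup avoids m′ (∈-++⁺ˡ (as⊆ m)))
        (λ { m (here eq) → fresh (here eq) (there (as⊆ m)) ; m (there m′) → fresh (there (short⊆long m′)) (there (as⊆ m)) })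
        (λ { m (here refl) → t∉xs m ; m (there m′) → All.lookup avoids m (∈-++⁺ʳ pre (short⊆long m′)) })

  module _ {y z y′ z′ : Fin n} (vy : v ⟶ y) (vz : v ⟶ z) (yz : y ⟶ z) (y′v : y′ ⟶ v) (z′v : z′ ⟶ v) (z′y′ : z′ ⟶ y′)
    {j : ℕ} (room : 5 * (6 + 3 * j) ≤ d) where

    private
      irr : ∀ {a b} → a ⟶ b → a ≢ b
      irr ab refl = irrefl refl ab
      two : ∀ {a b c} → a ⟶ b → b ⟶ c → a ≢ c
      two ab bc refl = asym ab bc
      apart : ∀ {a b} → v ⟶ a → b ⟶ v → b ≢ a
      apart va bv refl = asym va bv

    -- Three out-neighbours of z on a path make the lengths 2, …, 5 available from v.
    path-in-N⁺ : ∀ {x₁ x₂ x₃} → z ⟶ x₁ → z ⟶ x₂ → z ⟶ x₃ → x₁ ⟶ x₂ → x₂ ⟶ x₃ →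
                 (∀ {x} → x ∈ x₁ ∷ x₂ ∷ x₃ ∷ [] → x ∉ y′ ∷ z′ ∷ []) → OnCycle G v (9 + 3 * j)
    path-in-N⁺ {x₁} {x₂} {x₃} zx₁ zx₂ zx₃ x₁x₂ x₂x₃ x∉ = finish (length (proj₁ C)) refl (proj₁ bounds) (proj₂ bounds)
      where
      pre : List (Fin n)
      pre = v ∷ y ∷ z ∷ x₁ ∷ x₂ ∷ []
      u₄ : Unique (y ∷ z ∷ x₁ ∷ x₂ ∷ [])
      u₄ = (irr yz ∷ two yz zx₁ ∷ two yz zx₂ ∷ []) ∷ (irr zx₁ ∷ irr zx₂ ∷ []) ∷ (irr x₁x₂ ∷ []) ∷ [] ∷ []
      u₅ : Unique pre
      u₅ = (irr vy ∷ irr vz ∷ two vz zx₁ ∷ two vz zx₂ ∷ []) ∷ u₄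
      x₃∉pre : x₃ ∉ pre
      x₃∉pre (here eq)                                 = two vz zx₃ (sym eq)
      x₃∉pre (there (here eq))                         = two yz zx₃ (sym eq)
      x₃∉pre (there (there (here eq)))                 = irr zx₃ (sym eq)
      x₃∉pre (there (there (there (here eq))))         = two x₁x₂ x₂x₃ (sym eq)
      x₃∉pre (there (there (there (there (here eq))))) = irr x₂x₃ (sym eq)
      away : ∀ {w} → w ⟶ v → w ∈ y′ ∷ z′ ∷ [] → w ∉ x₃ ∷ pre
      away wv w∈ (here refl)                                         = x∉ (there (there (here refl))) w∈
      away wv w∈ (there (here eq))                                   = irr wv eq
      away wv w∈ (there (there (here eq)))                           = apart vy wv eq
      away wv w∈ (there (there (there (here eq))))                   = apart vz wv eq
      away wv w∈ (there (there (there (there (here refl)))))         = x∉ (here refl) w∈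
      away wv w∈ (there (there (there (there (there (here refl)))))) = x∉ (there (here refl)) w∈
      T : Tail (x₃ ∷ pre) z′ y′ (3 * j)
      T = tail (3 * j) z′v z′y′ y′v (away z′v (there (here refl))) (away y′v (here refl)) (enough-arith {j} room)
      open Tail T using (t; long-length)
      open Closing u₅ x₃∉pre T
      -- Here `pre` has 5 vertices and `long` has 3j + 1.
      small : 5 * length L ≤ d
      small = ≤-trans (≤-reflexive (cong (λ k → 5 * (5 + k)) long-length)) room
      C : Connection G L x₃ t 6
      C = let l , l∈ , tl = successor
              open Avoiding using (ball₃; ball₃-size)
              z∈ = there (there (here refl))
              L<d = shorter-arith {length L} (s≤s z≤n) small
              B  = ball₃ G L s∉L z∈ zx₃ (proj₁ ∘ deg≥) L<d
              B′ = ball₃ (G ᵒᵖ) L t∉L l∈ tl (proj₂ ∘ deg≥) L<d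
          in connect G L L-unique s≢t B B′
               (meet₃₃-arith {Ball.size B} {Ball.size B′} {d} {length L} (ball₃-size G L s∉L z∈ zx₃ (proj₁ ∘ deg≥) L<d) (ball₃-size (G ᵒᵖ) L t∉L l∈ tl (proj₂ ∘ deg≥) L<d) small n≤3d)
      bounds : 2 ≤ length (proj₁ C) × length (proj₁ C) ≤ 6
      bounds = let _ , _ , _ , _ , _ , l≥2 , l≤6 = C in l≥2 , l≤6
      head₁ : Head pre x₃ 1
      head₁ = z ∷ [] , vz ∷ zx₃ ∷ [] , (irr vz ∷ []) ∷ [] ∷ [] ,
              (λ { (here eq) → here eq ; (there (here eq)) → there (there (here eq)) }) , refl
      head₂ : Head pre x₃ 2
      head₂ = y ∷ z ∷ [] , vy ∷ yz ∷ zx₃ ∷ [] , (irr vy ∷ irr vz ∷ []) ∷ (irr yz ∷ []) ∷ [] ∷ [] ,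
              (λ { (here eq) → here eq ; (there (here eq)) → there (here eq) ; (there (there (here eq))) → there (there (here eq)) }) , refl
      head₃ : Head pre x₃ 3
      head₃ = z ∷ x₁ ∷ x₂ ∷ [] , vz ∷ zx₁ ∷ x₁x₂ ∷ x₂x₃ ∷ [] ,
              (irr vz ∷ two vz zx₁ ∷ two vz zx₂ ∷ []) ∷ (irr zx₁ ∷ irr zx₂ ∷ []) ∷ (irr x₁x₂ ∷ []) ∷ [] ∷ [] ,
              (λ { (here eq) → here eq ; (there m) → there (there m) }) , refl
      head₄ : Head pre x₃ 4
      head₄ = y ∷ z ∷ x₁ ∷ x₂ ∷ [] , vy ∷ yz ∷ zx₁ ∷ x₁x₂ ∷ x₂x₃ ∷ [] , u₅ , id , refl
      -- The long tail gives total length a + c + 3 + 3j and the short one a + c + 2 + 3j. So a = 6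
      -- - c with the long tail, except that c = 6 takes a = 1 with the short tail.
      finish : ∀ c → length (proj₁ C) ≡ c → 2 ≤ c → c ≤ 6 → OnCycle G v (9 + 3 * j)
      finish 1 _  (s≤s ()) _
      finish 2 lc _ _ = close-long head₄ C lc
      finish 3 lc _ _ = close-long head₃ C lc
      finish 4 lc _ _ = close-long head₂ C lc
      finish 5 lc _ _ = close-long head₁ C lc
      finish 6 lc _ _ = close-short head₁ C lc
      finish (suc (suc (suc (suc (suc (suc (suc _))))))) _ _ (s≤s (s≤s (s≤s (s≤s (s≤s (s≤s ()))))))

    no-path-in-N⁺ : (∀ {x₁ x₂ x₃} → z ⟶ x₁ → z ⟶ x₂ → z ⟶ x₃ → x₁ ⟶ x₂ → x₂ ⟶ x₃ →
                     (∀ {x} → x ∈ x₁ ∷ x₂ ∷ x₃ ∷ [] → x ∉ y′ ∷ z′ ∷ []) → ⊥) → OnCycle G v (9 + 3 * j)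
    no-path-in-N⁺ no-path = finish (length (proj₁ C)) refl (proj₁ bounds) (proj₂ bounds)
      where
      pre : List (Fin n)
      pre = v ∷ y ∷ []
      u₂ : Unique pre
      u₂ = (irr vy ∷ []) ∷ [] ∷ []
      z∉pre : z ∉ pre
      z∉pre (here eq)         = irr vz (sym eq)
      z∉pre (there (here eq)) = irr yz (sym eq)
      away : ∀ {w} → w ⟶ v → w ∉ z ∷ pre
      away wv (here eq)                 = apart vz wv eq
      away wv (there (here eq))         = irr wv eq
      away wv (there (there (here eq))) = apart vy wv eq
      T : Tail (z ∷ pre) z′ y′ (3 + 3 * j)
      T = tail (3 + 3 * j) z′v z′y′ y′v (away z′v) (away y′v) (enough-arith {j} room)
      open Tail T using (t; long; long-length; y′∈long; z′∈)
      open Closing u₂ z∉pre T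
      small : 5 * length L ≤ d
      small = ≤-trans (≤-reflexive (cong (λ k → 5 * (2 + k)) long-length)) room
      -- The ball around z already avoids y′ and z′, since y′ is in `long` and z′ is t or in `long`;
      -- so `no-path` applies inside it.
      listed : ∀ {x} → x ∉ L → x ≢ t → x ∉ y′ ∷ z′ ∷ []
      listed x∉ x≢t (here refl)         = x∉ (∈-++⁺ʳ pre y′∈long)
      listed x∉ x≢t (there (here refl)) = case-z′ z′∈
        where
        case-z′ : z′ ∈ t ∷ long → ⊥
        case-z′ (here eq) = x≢t eq
        case-z′ (there m) = x∉ (∈-++⁺ʳ pre m)
      C : Connection G L z t 4
      C = let l , l∈ , tl = successor
              open Avoiding using (wide; ball₂; ball₂-size)
              L<d = shorter-arith {length L} (s≤s z≤n) small
              B , B-size = wide G L z∉L (here refl) vz (proj₁ ∘ deg≥) L<d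
                (λ (zx₁ , x₁∉ , x₁≢t) (zx₂ , x₂∉ , x₂≢t) (zx₃ , x₃∉ , x₃≢t) x₁x₂ x₂x₃ → no-path zx₁ zx₂ zx₃ x₁x₂ x₂x₃
                  (λ { (here refl) → listed x₁∉ x₁≢t ; (there (here refl)) → listed x₂∉ x₂≢t ; (there (there (here refl))) → listed x₃∉ x₃≢t }))
              B′ = ball₂ (G ᵒᵖ) L t∉L l∈ tl (proj₂ ∘ deg≥) L<d
          in connect G L L-unique s≢t B B′
               (meet₂₂-arith {Ball.size B} {Ball.size B′} {d} {length L} B-size (ball₂-size (G ᵒᵖ) L t∉L l∈ tl (proj₂ ∘ deg≥) L<d) small n≤3d)
        where
        z∉L : z ∉ L
        z∉L = s∉L
      bounds : 2 ≤ length (proj₁ C) × length (proj₁ C) ≤ 4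
      bounds = let _ , _ , _ , _ , _ , l≥2 , l≤4 = C in l≥2 , l≤4
      head₀ : Head pre z 0
      head₀ = [] , vz ∷ [] , [] ∷ [] , (λ { (here eq) → here eq }) , refl
      head₁ : Head pre z 1
      head₁ = y ∷ [] , vy ∷ yz ∷ [] , u₂ , id , refl
      -- With p = 3 + 3j the total is a + c + 6 + 3j for the long tail and one less for the short
      -- one, which c = 4 requires.
      finish : ∀ c → length (proj₁ C) ≡ c → 2 ≤ c → c ≤ 4 → OnCycle G v (9 + 3 * j)
      finish 1 _  (s≤s ()) _
      finish 2 lc _ _ = close-long head₁ C lc
      finish 3 lc _ _ = close-long head₀ C lc
      finish 4 lc _ _ = close-short head₀ C lc
      finish (suc (suc (suc (suc (suc _))))) _ _ (s≤s (s≤s (s≤s (s≤s ()))))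

    long-cycle : OnCycle G v (9 + 3 * j)
    long-cycle with any? (λ x₁ → any? λ x₂ → any? λ x₃ →
                     (((z ⟶? x₁) ×-dec ((z ⟶? x₂) ×-dec (z ⟶? x₃))) ×-dec ((x₁ ⟶? x₂) ×-dec (x₂ ⟶? x₃)))
                     ×-dec All.all? (λ x → ¬? (x ∈? (y′ ∷ z′ ∷ []))) (x₁ ∷ x₂ ∷ x₃ ∷ []))
    ... | yes (_ , _ , _ , ((zx₁ , zx₂ , zx₃) , x₁x₂ , x₂x₃) , x∉) = path-in-N⁺ zx₁ zx₂ zx₃ x₁x₂ x₂x₃ (All.lookup x∉)
    ... | no ¬path = no-path-in-N⁺ λ zx₁ zx₂ zx₃ x₁x₂ x₂x₃ x∉ →
                       ¬path (_ , _ , _ , ((zx₁ , zx₂ , zx₃) , x₁x₂ , x₂x₃) , All.tabulate x∉)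

-- The extremal graph

data Colour : Set where
  c₀ c₁ c₂ : Colour

shift : Colour → Colour
shift c₀ = c₁
shift c₁ = c₂
shift c₂ = c₀

shift³ : ∀ c → shift (shift (shift c)) ≡ c
shift³ c₀ = refl
shift³ c₁ = refl
shift³ c₂ = refl

_≟ᶜ_ : (c c′ : Colour) → Dec (c ≡ c′)
c₀ ≟ᶜ c₀ = yes refl
c₀ ≟ᶜ c₁ = no λ ()
c₀ ≟ᶜ c₂ = no λ ()
c₁ ≟ᶜ c₀ = no λ ()
c₁ ≟ᶜ c₁ = yes refl
c₁ ≟ᶜ c₂ = no λ ()
c₂ ≟ᶜ c₀ = no λ ()
c₂ ≟ᶜ c₁ = no λ ()
c₂ ≟ᶜ c₂ = yes refl

colourFrom : Colour → ℕ → Colour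
colourFrom c zero    = c
colourFrom c (suc k) = colourFrom (shift c) k

opaque
  unfolding #

  #-suc : ∀ {n} {P : Fin (suc n) → Set} (P? : Decidable P) → ind (P? zero) + # (P? ∘ suc) ≡ # P?
  #-suc P? = refl

#-tail : ∀ {n} {P : Fin (suc n) → Set} (P? : Decidable P) → # (P? ∘ suc) ≤ # P?
#-tail P? = ≤-trans (m≤n+m _ _) (≤-reflexive (#-suc P?))

#-head : ∀ {n} {P : Fin (suc n) → Set} (P? : Decidable P) → P zero → suc (# (P? ∘ suc)) ≤ # P?
#-head P? p with P? zero | #-suc P?
... | yes _ | eq = ≤-reflexive eq
... | no ¬p | _  = contradiction p ¬p

class? : ∀ n s c → Decidable (λ (j : Fin n) → colourFrom s (toℕ j) ≡ c)
class? n s c j = colourFrom s (toℕ j) ≟ᶜ c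

-- Each colour occurs once among three consecutive indices; its offset from s tells which of the
-- three is counted.
class-size : ∀ k {n} s c → k * 3 ≤ n → k ≤ # (class? n s c)
class-size zero    s c _ = z≤n
class-size (suc k) s c (s≤s (s≤s (s≤s {n = n} le))) = hit s c refl
  where
  skip : ∀ n s → # (class? n (shift s) c) ≤ # (class? (suc n) s c)
  skip n s = #-tail {P = λ j → colourFrom s (toℕ j) ≡ c} (class? (suc n) s c)
  take : ∀ n s → s ≡ c → suc (# (class? n (shift s) c)) ≤ # (class? (suc n) s c)
  take n s = #-head {P = λ j → colourFrom s (toℕ j) ≡ c} (class? (suc n) s c)
  rest : ∀ s → k ≤ # (class? n s c)
  rest s = class-size k s c le
  first : ∀ s → s ≡ c → suc k ≤ # (class? (3 + n) s c)
  first s eq = ≤-trans (s≤s (≤-trans (rest (shift (shift (shift s)))) (≤-trans (skip n (shift (shift s))) (skip (1 + n) (shift s)))))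
                       (take (2 + n) s eq)
  second : ∀ s → shift s ≡ c → suc k ≤ # (class? (3 + n) s c)
  second s eq = ≤-trans (s≤s (≤-trans (rest (shift (shift (shift s)))) (skip n (shift (shift s)))))
                        (≤-trans (take (1 + n) (shift s) eq) (skip (2 + n) s))
  third : ∀ s → shift (shift s) ≡ c → suc k ≤ # (class? (3 + n) s c)
  third s eq = ≤-trans (s≤s (rest (shift (shift (shift s)))))
                       (≤-trans (take n (shift (shift s)) eq) (≤-trans (skip (1 + n) (shift s)) (skip (2 + n) s)))
  hit : ∀ s c′ → c′ ≡ c → suc k ≤ # (class? (3 + n) s c)
  hit c₀ c₀ eq = first c₀ eq
  hit c₀ c₁ eq = second c₀ eq
  hit c₀ c₂ eq = third c₀ eq
  hit c₁ c₀ eq = third c₁ eq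
  hit c₁ c₁ eq = first c₁ eq
  hit c₁ c₂ eq = second c₁ eq
  hit c₂ c₀ eq = second c₂ eq
  hit c₂ c₁ eq = third c₂ eq
  hit c₂ c₂ eq = first c₂ eq

module Extremal (m : ℕ) where

  colour : Fin m → Colour
  colour j = colourFrom c₀ (toℕ j)

  -- A blow-up of the directed triangle with classes of size at least ⌊m/3⌋, and a
  -- vertex zero which receives arcs from the class c₂ and sends arcs to c₀.
  Arc : Fin (suc m) → Fin (suc m) → Set
  Arc zero    zero    = ⊥
  Arc zero    (suc j) = colour j ≡ c₀
  Arc (suc i) zero    = colour i ≡ c₂
  Arc (suc i) (suc j) = shift (colour i) ≡ colour j

  Arc? : ∀ x y → Dec (Arc x y)
  Arc? zero    zero    = no id
  Arc? zero    (suc j) = colour j ≟ᶜ c₀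
  Arc? (suc i) zero    = colour i ≟ᶜ c₂
  Arc? (suc i) (suc j) = shift (colour i) ≟ᶜ colour j

  shift≢ : ∀ {c} → ¬ shift c ≡ c
  shift≢ {c₀} ()
  shift≢ {c₁} ()
  shift≢ {c₂} ()

  shift²≢ : ∀ {c} → ¬ shift (shift c) ≡ c
  shift²≢ {c₀} ()
  shift²≢ {c₁} ()
  shift²≢ {c₂} ()

  extremal : OrientedGraph (suc m)
  extremal = record
    { _⟶_    = Arc
    ; _⟶?_   = Arc?
    ; irrefl = λ { {zero} refl () ; {suc i} refl eq → shift≢ eq }
    ; asym   = λ {x} {y} → asym x y
    }
    where
    asym : ∀ x y → Arc x y → ¬ Arc y x
    asym zero    (suc j) eq eq′ = contradiction (trans (sym eq) eq′) λ ()
    asym (suc i) zero    eq eq′ = contradiction (trans (sym eq) eq′) λ ()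
    asym (suc i) (suc j) eq eq′ = shift²≢ (trans (cong shift eq) eq′)

  open OrientedGraph extremal using (δ⁰)
  open Degrees extremal

  class≥ : ∀ c → m / 3 ≤ # (λ j → colour j ≟ᶜ c)
  class≥ c = class-size (m / 3) c₀ c (m/n*n≤m m 3)

  δ⁰-extremal : m / 3 ≤ δ⁰
  δ⁰-extremal = deg≥⇒δ⁰≥ (≤-trans (≤-trans (m≤m*n (m / 3) 3) (m/n*n≤m m 3)) (n≤1+n m)) λ v → out v , into v
    where
    out : ∀ v → m / 3 ≤ deg⁺ v
    out zero    = ≤-trans (class≥ c₀) (#-tail (Arc? zero))
    out (suc i) = ≤-trans (class≥ (shift (colour i)))
      (≤-trans (#-mono (λ j → colour j ≟ᶜ shift (colour i)) (λ j → Arc? (suc i) (suc j)) sym) (#-tail (Arc? (suc i))))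
    into : ∀ v → m / 3 ≤ deg⁻ v
    into zero    = ≤-trans (class≥ c₂) (#-tail (λ x → Arc? x zero))
    into (suc j) = ≤-trans (class≥ (shift (shift (colour j))))
      (≤-trans (#-mono (λ i → colour i ≟ᶜ shift (shift (colour j))) (λ i → Arc? (suc i) (suc j))
                 (λ eq → trans (cong shift eq) (shift³ (colour j))))
               (#-tail (λ x → Arc? x (suc j))))

  -- The colour advances along every arc except those leaving zero, which is given
  -- the colour c₀; hence the length of a cycle through zero is 1 modulo 3.
  φ : Fin (suc m) → Colour
  φ zero    = c₀
  φ (suc j) = colour j

  φ-step : ∀ {x y} → Arc x y → x ≢ zero → φ y ≡ shift (φ x)
  φ-step {zero}          _  x≢0 = contradiction refl x≢0
  φ-step {suc i} {zero}  eq _   = sym (cong shift eq)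
  φ-step {suc i} {suc j} eq _   = sym eq

  φ-start : ∀ {y} → Arc zero y → φ y ≡ c₀
  φ-start {suc j} eq = eq

  turns : ℕ → Colour
  turns zero    = c₀
  turns (suc k) = shift (turns k)

  turns-*3 : ∀ q → turns (q * 3) ≡ c₀
  turns-*3 zero    = refl
  turns-*3 (suc q) = trans (shift³ _) (turns-*3 q)

  module _ {l : ℕ} (C : CycleCopy extremal (suc l)) {i₀ : Fin (suc l)} (i₀↦0 : CycleCopy.vertex C i₀ ≡ zero) where
    open CycleCopy C

    -- Re-indexes the cycle so that it starts at the vertex `zero`.
    position : ℕ → Fin (suc l)
    position k = (toℕ i₀ + k) mod suc l

    toℕ-position : ∀ k → toℕ (position k) ≡ (toℕ i₀ + k) % suc l
    toℕ-position k = toℕ-fromℕ< (m%n<n (toℕ i₀ + k) (suc l))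

    position-next : ∀ k → next (position k) ≡ position (suc k)
    position-next k = toℕ-injective (begin
      toℕ (next (position k))             ≡⟨ toℕ-next (position k) ⟩
      suc (toℕ (position k)) % suc l      ≡⟨ cong (λ x → suc x % suc l) (toℕ-position k) ⟩
      (1 + a % suc l) % suc l             ≡⟨ %-distribˡ-+ 1 (a % suc l) (suc l) ⟩
      (1 % suc l + a % suc l % suc l) % suc l ≡⟨ cong (λ x → (1 % suc l + x) % suc l) (m%n%n≡m%n a (suc l)) ⟩
      (1 % suc l + a % suc l) % suc l     ≡⟨ %-distribˡ-+ 1 a (suc l) ⟨
      suc a % suc l                       ≡⟨ cong (_% suc l) (+-suc (toℕ i₀) k) ⟨
      (toℕ i₀ + suc k) % suc l            ≡⟨ toℕ-position (suc k) ⟨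
      toℕ (position (suc k))              ∎)
      where
      open ≡-Reasoning
      a : ℕ
      a = toℕ i₀ + k

    i₀%≡ : toℕ i₀ % suc l ≡ toℕ i₀
    i₀%≡ = m<n⇒m%n≡m (toℕ<n i₀)

    at : ℕ → Fin (suc m)
    at k = vertex (position k)

    at-arc : ∀ k → Arc (at k) (at (suc k))
    at-arc k = subst (λ i → Arc (at k) (vertex i)) (position-next k) (arc (position k))

    at-0 : at 0 ≡ zero
    at-0 = trans (cong vertex (toℕ-injective (trans (toℕ-position 0) (trans (cong (_% suc l) (+-identityʳ (toℕ i₀))) i₀%≡)))) i₀↦0

    at-ℓ : at (suc l) ≡ zero
    at-ℓ = trans (cong vertex (toℕ-injective (trans (toℕ-position (suc l)) (trans ([m+n]%n≡m%n (toℕ i₀) (suc l)) i₀%≡)))) i₀↦0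

    -- By injectivity, a visit to `zero` at k makes k a multiple of the cycle length.
    at≢0 : ∀ {k} → 1 ≤ k → k < suc l → at k ≢ zero
    at≢0 {k} 1≤k k<ℓ eq = multiple ((toℕ i₀ + k) / suc l) (+-cancelˡ-≡ (toℕ i₀) _ _ (trans (m≡m%n+[m/n]*n (toℕ i₀ + k) (suc l))
        (cong (_+ (toℕ i₀ + k) / suc l * suc l) (trans (sym (toℕ-position k)) (cong toℕ (injective (trans eq (sym i₀↦0))))))))
      where
      multiple : ∀ c → k ≡ c * suc l → ⊥
      multiple zero    k≡ = <⇒≢ 1≤k (sym k≡)
      multiple (suc c) k≡ = <⇒≱ k<ℓ (≤-trans (m≤m+n (suc l) (c * suc l)) (≤-reflexive (sym k≡)))

    -- The index is shifted by one because the arc leaving `zero` does not advance the colour.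
    φ-at : ∀ k → k < suc l → φ (at (suc k)) ≡ turns k
    φ-at zero    _  = φ-start (subst (λ x → Arc x (at 1)) at-0 (at-arc 0))
    φ-at (suc k) lt = trans (φ-step (at-arc (suc k)) (at≢0 (s≤s z≤n) lt)) (cong shift (φ-at k (<-trans (n<1+n k) lt)))

    length≢*3 : ∀ q → suc l ≢ q * 3
    length≢*3 q eq = contradiction (begin
      c₁                 ≡⟨ cong (shift ∘ φ) at-ℓ ⟨
      shift (φ (at (suc l))) ≡⟨ cong shift (φ-at l (n<1+n l)) ⟩
      turns (suc l)      ≡⟨ cong turns eq ⟩
      turns (q * 3)      ≡⟨ turns-*3 q ⟩
      c₀                 ∎) λ ()
      where open ≡-Reasoning

-- Combination of the cases, and the two bounds

independent-or-both : ∀ {n} (G : OrientedGraph n) (let open OrientedGraph G) (v : Fin n) {d s k ℓ : ℕ} → n ≤ 3 * d →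
            (∀ x → d ≤ Degrees.deg⁺ G x × d ≤ Degrees.deg⁻ G x) → s ≡ suc k → 13 * s ≤ d → 3 * suc s ≡ ℓ →
            (∀ {y z y′ z′} → v ⟶ y → v ⟶ z → y ⟶ z → y′ ⟶ v → z′ ⟶ v → z′ ⟶ y′ → OnCycle G v ℓ) →
            OnCycle G v ℓ
independent-or-both G v n≤3d deg≥ s≡ 13s≤d refl both
  with any? (λ y → any? λ z → ((v ⟶? y) ×-dec (v ⟶? z)) ×-dec (y ⟶? z))
     | any? (λ y → any? λ z → ((y ⟶? v) ×-dec (z ⟶? v)) ×-dec (z ⟶? y))
  where open OrientedGraph G
... | no ¬arc | _ = Independent.onCycle G v n≤3d deg≥ (λ vy vz yz → ¬arc (_ , _ , (vy , vz) , yz)) s≡ 13s≤d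
... | yes _   | no ¬arc = onCycle-op {G = G}
        (Independent.onCycle (G ᵒᵖ) v n≤3d (λ x → proj₂ (deg≥ x) , proj₁ (deg≥ x))
          (λ yv zv zy → ¬arc (_ , _ , (yv , zv) , zy)) s≡ 13s≤d)
... | yes (_ , _ , (vy , vz) , yz) | yes (_ , _ , (y′v , z′v) , z′y′) = both vy vz yz y′v z′v z′y′

every-vertex-on-cycle : ∀ {q n d} → q ≥ 2 → n ≥ n₀ q → n ≤ 3 * d → (G : OrientedGraph n) →
                        (∀ x → d ≤ Degrees.deg⁺ G x × d ≤ Degrees.deg⁻ G x) → ∀ v → OnCycle G v (3 * q)
every-vertex-on-cycle {0}                       ()
every-vertex-on-cycle {1}                       (s≤s ())
every-vertex-on-cycle {2} {n} {d} _ n≥ n≤3d G deg≥ v =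
  independent-or-both G v {d} {1} n≤3d deg≥ refl 13≤d refl (hexagon G n≤3d (≤-trans (m≤m+n 7 6) 13≤d) deg≥)
  where
  13≤d : 13 ≤ d
  -- 36 < n ≤ 3d forces d > 12, as needed for 13s ≤ d with s = 1.
  13≤d = *-cancelˡ-< 3 12 d (≤-trans n≥ n≤3d)
every-vertex-on-cycle {3} {n} {d} _ n≥ n≤3d G deg≥ v =
  independent-or-both G v {d} {2} n≤3d deg≥ refl (≤-trans (m≤m+n 26 7) 33≤d) refl
    (λ vy vz yz y′v z′v z′y′ → Segments.long-cycle G v n≤3d deg≥ vy vz yz y′v z′v z′y′ {0} (≤-trans (m≤m+n 30 3) 33≤d))
  where
  33≤d : 33 ≤ d
  -- 96 < n ≤ 3d forces d > 32, which covers 13s = 26 for s = 2 and 5(6 + 3j) = 30 for j = 0.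
  33≤d = *-cancelˡ-< 3 32 d (≤-trans n≥ n≤3d)
every-vertex-on-cycle {q@(suc (suc (suc (suc i))))} {n} {d} _ n≥ n≤3d G deg≥ v =
  -- Here s = q - 1 = 3 + i and j = q - 3 = 1 + i.
  independent-or-both G v {d} {3 + i} n≤3d deg≥ refl (thirteen-arith 45q≤3d+8) refl
    (λ vy vz yz y′v z′v z′y′ → subst (OnCycle G v) (length≡ i)
      (Segments.long-cycle G v n≤3d deg≥ vy vz yz y′v z′v z′y′ {suc i} (fifteen-arith 45q≤3d+8)))
  where
  45q≤3d+8 : 45 * (4 + i) ≤ 8 + 3 * d
  45q≤3d+8 = ≤-trans (m≤n+m∸n (45 * q) 8) (+-monoʳ-≤ 8 (≤-trans n≥ n≤3d))
  length≡ : ∀ i → 9 + 3 * suc i ≡ 3 * (4 + i)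
  length≡ = solve-∀

n≤3⌈n/3⌉ : ∀ n → n ≤ 3 * ⌈ n /3⌉
n≤3⌈n/3⌉ n = +-cancelʳ-≤ 2 n _ (begin
  n + 2                                  ≡⟨ m≡m%n+[m/n]*n (n + 2) 3 ⟩
  (n + 2) % 3 + (n + 2) / 3 * 3          ≤⟨ +-monoˡ-≤ _ (≤-pred (m%n<n (n + 2) 3)) ⟩
  2 + (n + 2) / 3 * 3                    ≡⟨ +-comm 2 _ ⟩
  (n + 2) / 3 * 3 + 2                    ≡⟨ cong (_+ 2) (*-comm ((n + 2) / 3) 3) ⟩
  3 * ((n + 2) / 3) + 2                  ∎)
  where open ≤-Reasoning

⌈1+m/3⌉ : ∀ m → ⌈ suc m /3⌉ ≡ suc (m / 3)
⌈1+m/3⌉ m = trans (cong (_/ 3) (+-comm (suc m) 2)) (m/n≡1+[m∸n]/n {3 + m} {3} (m≤m+n 3 m))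

upper : ∀ {q n} → q ≥ 2 → n ≥ n₀ q → ForcesVertexCycles (3 * q) n ⌈ n /3⌉
upper {n = n} q≥2 n≥ G δ⁰≥ v =
  cycleCopy {G = G} (every-vertex-on-cycle q≥2 n≥ (n≤3⌈n/3⌉ n) G (Degrees.δ⁰≥⇒deg≥ G δ⁰≥) v)

lower : ∀ {q m d} → q ≥ 2 → ForcesVertexCycles (3 * q) (suc m) d → ⌈ suc m /3⌉ ≤ d
-- If d is below ⌈(m + 1)/3⌉ = 1 + ⌊m/3⌋, the extremal graph satisfies the degree condition. The
-- pattern `suc q` makes the cycle length a successor, as `length≢*3` expects.
lower {suc q} {m} {d} _ forces = ≮⇒≥ λ d< →
  let C , i₀ , i₀↦0 = forces (extremal) (≤-trans (≤-pred (≤-trans d< (≤-reflexive (⌈1+m/3⌉ m)))) δ⁰-extremal) zero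
  in length≢*3 C i₀↦0 (suc q) (*-comm 3 (suc q))
  where open Extremal m

n₀>0 : ∀ {q} → q ≥ 2 → n₀ q ≥ 1
n₀>0 {1} (s≤s ())
n₀>0 {2} _ = s≤s z≤n
n₀>0 {3} _ = s≤s z≤n
n₀>0 {suc (suc (suc (suc i)))} _ = m<n⇒0<n∸m {8} {45 * (4 + i)} (≤-trans (m≤m+n 9 171) (*-monoʳ-≤ 45 (m≤m+n 4 i)))

corollary1p2 : ∀ (q : ℕ) → q ≥ 2 → ∀ (n : ℕ) → n ≥ n₀ q → τᵛ[ 3 * q , n ]≡ ⌈ n /3⌉
corollary1p2 q q≥2 zero    n≥ = contradiction (≤-trans (n₀>0 q≥2) n≥) λ ()
corollary1p2 q q≥2 (suc m) n≥ = upper {q} q≥2 n≥ , λ d → lower q≥2
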